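{- Let $q \geq 4$ be a prime power, let $d\ge 1$ be an integer, and let $1\le j\le d$. Then: (i) If $d \geq 3$, then $|Q_j(i+1)| < |Q_j(i)|$ for $0 \leq i \leq d-1$. (ii) If $j$ is odd, then $Q_j(1) \leq Q_j(i)$ for $0 \leq i \leq d$. (iii) If $j$ is even, then $Q_j(d-j+2) \leq Q_j(i)$ for $0 \leq i \leq d$.
   Context: Put $b=-q$. With Gaussian coefficients in base $b$, $\genfrac{[}{]}{0pt}{}{a}{k}_b = \prod_{h=0}^{k-1}\frac{b^{a-h}-1}{b^{k-h}-1}$ (and $0$ if $k<0$), for $0\le i,j\le d$, $$Q_j(i) = (-1)^j \sum_{h=0}^j (-q)^{\binom{j-h}{2} + hd} \genfrac{[}{]}{0pt}{}{d-h}{d-j}_b \genfrac{[}{]}{0pt}{}{d-i}{h}_b.$$ The numbers $Q_j(i)$, $0\le i\le d$, are the eigenvalues of the distance-$j$ graph of the Hermitian forms graph $Q_q(d)$, whose vertices are the Hermitian $d\times d$ matrices over $\mathbb{F}_{q^2}$, adjacent when their difference has rank 1. -}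

module Defs where

open import Data.Fin.Base using (Fin; toℕ)
open import Data.Fin.Properties using (toℕ<n)
open import Data.Integer.Base as ℤ using (ℤ; +_; -_; 1ℤ; -1ℤ; _^_; ∣_∣)
import Data.Integer.Properties as ℤ
open import Data.Nat.Base as ℕ using (ℕ; suc; _∸_; _≤_; NonZero; NonTrivial)
open import Data.Nat.Combinatorics using (_C_)
open import Data.Nat.Primality using (Prime)
import Data.Nat.Properties as ℕ
open import Data.Product.Base using (_×_; ∃₂)
open import Data.Rational.Base using (ℚ; _*_; _÷_)
open import Data.Rational.Literals using (fromℤ)
open import Data.Rational.Properties using (+-0-commutativeMonoid; *-1-commutativeMonoid)
open import Relation.Binary.PropositionalEquality
  using (_≡_; sym; trans; cong)
open import Relation.Nullary using (contradiction)

open import Algebra.Properties.CommutativeMonoid.Sum +-0-commutativeMonoid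
  using (sum⁺-syntax)
open import Algebra.Properties.CommutativeMonoid.Sum *-1-commutativeMonoid
  using () renaming (sum to product)

IsPrimePower : ℕ → Set
IsPrimePower q = ∃₂ λ p n → Prime p × 1 ≤ n × q ≡ p ℕ.^ n

b^n-1≢0 : ∀ (b : ℤ) .{{_ : NonTrivial ∣ b ∣}} n .{{_ : NonZero n}} →
          ℤ.NonZero (b ^ n ℤ.- 1ℤ)
b^n-1≢0 b (suc n) = ℤ.≢-nonZero λ b^n-1≡0 →
  contradiction (ℕ.m*n≡1⇒m≡1 ∣ b ∣ ∣ b ^ n ∣ (∣b∣*∣b^n∣≡1 b^n-1≡0))
                (ℕ.nonTrivial⇒≢1 {∣ b ∣})
  where
  ∣b∣*∣b^n∣≡1 : b ^ suc n ℤ.- 1ℤ ≡ + 0 → ∣ b ∣ ℕ.* ∣ b ^ n ∣ ≡ 1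
  ∣b∣*∣b^n∣≡1 eq = trans (sym (ℤ.abs-* b (b ^ n)))
                         (cong ∣_∣ (ℤ.i-j≡0⇒i≡j (b ^ suc n) 1ℤ eq))

k∸h≢0 : ∀ {k} (h : Fin k) → NonZero (k ∸ toℕ h)
k∸h≢0 h = ℕ.>-nonZero (ℕ.m<n⇒0<n∸m (toℕ<n h))

-- The Gaussian coefficient ∏_{h=0}^{k-1} (bᵃ⁻ʰ - 1)/(bᵏ⁻ʰ - 1).  If a < k, the
-- factor h = a vanishes, so truncating a - h in the factors with h > a is
-- harmless.  Negative k never arises in Q below.
gaussian : (b : ℤ) .{{_ : NonTrivial ∣ b ∣}} → ℕ → ℕ → ℚ
gaussian b a k = product {k} λ h →
  (fromℤ (b ^ (a ∸ toℕ h) ℤ.- 1ℤ) ÷ fromℤ (b ^ (k ∸ toℕ h) ℤ.- 1ℤ))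
    {{b^n-1≢0 b (k ∸ toℕ h) {{k∸h≢0 h}}}}

∣-q∣-nonTrivial : ∀ q .{{_ : NonTrivial q}} → NonTrivial ∣ - (+ q) ∣
∣-q∣-nonTrivial (suc (suc q)) = _

-- Q q d j i is Q_j(i), meaningful for i, j ≤ d (so that no subtraction of
-- natural numbers is truncated; h ranges over 0, …, j).
Q : (q : ℕ) .{{_ : NonTrivial q}} → ℕ → ℕ → ℕ → ℚ
Q q d j i =
  fromℤ (-1ℤ ^ j) *
  (∑[ h ≤ j ] (fromℤ (b ^ ((j ∸ toℕ h) C 2 ℕ.+ toℕ h ℕ.* d))
               * [ d ∸ toℕ h , d ∸ j ]
               * [ d ∸ i , toℕ h ]))
  where
  b : ℤ
  b = - (+ q)
  [_,_] : ℕ → ℕ → ℚ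
  [ a , k ] = gaussian b {{∣-q∣-nonTrivial q}} a k

-- Put b = -q and m = d - i.  The q-Pascal rules give
--   Q_j^d(i)   = Q_j^d(i+1) - b^(2d-i-1) Q_{j-1}^{d-1}(i),
--   Q_j^d(i+1) = b^j Q_j^{d-1}(i) - b^(j-1) Q_{j-1}^{d-1}(i),
-- hence Q_j^d(i) = E - b^(2d-i-1) Q_{j-1}^{d-1}(i) with E = Q_j^d(i+1).  As long as
-- |Q_j^{d-1}(i)| is at most 3/2 q^(2d-2-i-j) |Q_{j-1}^{d-1}(i)|, the term E is less
-- than half of the other one in absolute value.  This gives (i), and it also
-- determines Q_j^d(i) up to a factor between 1/2 and 3/2: each step d-1 → d,
-- j-1 → j multiplies the ratio |Q_j/Q_{j-1}| by at most 3, while the bound for it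
-- grows by a factor q ≥ 4, so the bound persists.  It remains to treat j = 1 and
-- i = d, where there are product formulas.  Finally sgn Q_j^d(i) =
-- (-1)^i sgn Q_{j-1}^{d-1}(i), so two steps preserve the sign, and (ii) and (iii)
-- follow from (i) and from the signs for j ≤ 2.
module Submission where

open import Defs
open import Data.Fin.Base using (Fin; toℕ)
open import Data.Fin.Properties using (toℕ≤pred[n])
import Data.Integer.Base as ℤ
import Data.Integer.Properties as ℤ
open import Data.Integer.Tactic.RingSolver using (solve-∀)
open import Data.Nat.Combinatorics using (_C_; nCk+nC[k+1]≡[n+1]C[k+1]; nC1≡n)
import Data.Nat.Properties as ℕ
import Data.Nat.Tactic.RingSolver as ℕ-Solver
open import Data.Product.Base using (_,_; ∃)
import Data.Rational.Base as ℚ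
open import Data.Rational.Literals using (fromℤ)
import Data.Rational.Properties as ℚ
import Data.Rational.Unnormalised.Base as ℚᵘ
import Data.Rational.Unnormalised.Properties as ℚᵘ
import Data.Sign.Base as Sign
import Data.Sign.Properties as Sign
open import Data.Sum.Base using (_⊎_; inj₁; inj₂)
open import Relation.Binary.PropositionalEquality
open import Relation.Nullary using (yes; no; contradiction)
open import Algebra.Properties.CommutativeMonoid.Sum ℚ.+-0-commutativeMonoid
  using (sum; sum-cong-≗)
open import Algebra.Properties.CommutativeMonoid.Sum ℚ.*-1-commutativeMonoid
  using () renaming (sum to product)

-- Gaussian coefficients in an integer base.

module Recurrences where
  open import Data.Integer.Base hiding (suc)
  open import Data.Nat.Base as ℕ using (ℕ; zero; suc; _∸_)
  open ≡-Reasoning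

  module GaussianBinomial (b : ℤ) where

    -- Defined by a Pascal rule instead of a quotient, so that all values are integers and no base
    -- has to be excluded. `gaussian≡binom` identifies it with the product formula.
    binom : ℕ → ℕ → ℤ
    binom n       zero    = 1ℤ
    binom zero    (suc k) = 0ℤ
    binom (suc n) (suc k) = b ^ suc k * binom n (suc k) + binom n k

    n<k⇒binom≡0 : ∀ {n k} → n ℕ.< k → binom n k ≡ 0ℤ
    n<k⇒binom≡0 {zero}  {suc k} _ = refl
    n<k⇒binom≡0 {suc n} {suc k} (ℕ.s≤s n<k) = begin
      b ^ suc k * binom n (suc k) + binom n k
        ≡⟨ cong₂ (λ x y → b ^ suc k * x + y)
             (n<k⇒binom≡0 (ℕ.m<n⇒m<1+n n<k)) (n<k⇒binom≡0 n<k) ⟩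
      b ^ suc k * 0ℤ + 0ℤ
        ≡⟨ cong (_+ 0ℤ) (ℤ.*-zeroʳ (b ^ suc k)) ⟩
      0ℤ ∎

    -- For `n < k` the difference `n ∸ k` is truncated and the exponents do not add up to `suc n`.
    -- The factor `x`, in practice a Gaussian coefficient, vanishes in that range and saves the
    -- equation.
    merge-powers : ∀ n k {x} → (n ℕ.< k → x ≡ 0ℤ) →
                   b ^ suc k * b ^ (n ∸ k) * x ≡ b ^ suc n * x
    merge-powers n k {x} vanish with k ℕ.≤? n
    ... | yes k≤n = cong (_* x) (begin
      b ^ suc k * b ^ (n ∸ k) ≡⟨ ℤ.^-distribˡ-+-* b (suc k) (n ∸ k) ⟨
      b ^ suc (k ℕ.+ (n ∸ k)) ≡⟨ cong (λ e → b ^ suc e) (ℕ.m+[n∸m]≡n k≤n) ⟩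
      b ^ suc n               ∎)
    ... | no k≰n = begin
      b ^ suc k * b ^ (n ∸ k) * x ≡⟨ cong (b ^ suc k * b ^ (n ∸ k) *_) x≡0 ⟩
      b ^ suc k * b ^ (n ∸ k) * 0ℤ ≡⟨ ℤ.*-zeroʳ (b ^ suc k * b ^ (n ∸ k)) ⟩
      0ℤ                           ≡⟨ ℤ.*-zeroʳ (b ^ suc n) ⟨
      b ^ suc n * 0ℤ               ≡⟨ cong (b ^ suc n *_) x≡0 ⟨
      b ^ suc n * x                ∎
      where
      x≡0 = vanish (ℕ.≰⇒> k≰n)

    -- The quotients of neighbouring Gaussian coefficients with denominators cleared, proved by
    -- simultaneous induction on `n`. The first identity yields the dual Pascal rule, the second the
    -- product formula.
    absorption : ∀ n k → (b ^ suc k - 1ℤ) * binom n (suc k) ≡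
                         (b ^ (n ∸ k) - 1ℤ) * binom n k
    absorption-suc : ∀ n k → (b ^ suc k - 1ℤ) * binom (suc n) (suc k) ≡
                             (b ^ suc n - 1ℤ) * binom n k

    absorption zero    zero    = ℤ.*-zeroʳ (b ^ 1 - 1ℤ)
    absorption zero    (suc k) = ℤ.*-zeroʳ (b ^ suc (suc k) - 1ℤ)
    absorption (suc n) zero    = absorption-suc n 0
    absorption (suc n) (suc k) = begin
      (b ^ suc (suc k) - 1ℤ) * binom (suc n) (suc (suc k))
        ≡⟨ absorption-suc n (suc k) ⟩
      (b ^ suc n - 1ℤ) * x
        ≡⟨ expand (b ^ suc n) x ⟩
      b ^ suc n * x - x
        ≡⟨ cong (_- x) (merge-powers n k (λ n<k → n<k⇒binom≡0 (ℕ.m<n⇒m<1+n n<k))) ⟨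
      b ^ suc k * b ^ (n ∸ k) * x - x
        ≡⟨ regroup (b ^ suc k) (b ^ (n ∸ k)) x ⟩
      (b ^ (n ∸ k) - 1ℤ) * (b ^ suc k * x) + (b ^ suc k - 1ℤ) * x
        ≡⟨ cong (λ y → (b ^ (n ∸ k) - 1ℤ) * (b ^ suc k * x) + y) (absorption n k) ⟩
      (b ^ (n ∸ k) - 1ℤ) * (b ^ suc k * x) + (b ^ (n ∸ k) - 1ℤ) * binom n k
        ≡⟨ ℤ.*-distribˡ-+ (b ^ (n ∸ k) - 1ℤ) (b ^ suc k * x) (binom n k) ⟨
      (b ^ (n ∸ k) - 1ℤ) * (b ^ suc k * x + binom n k) ∎
      where
      x = binom n (suc k)
      expand : ∀ p x → (p - 1ℤ) * x ≡ p * x - x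
      expand = solve-∀
      regroup : ∀ p r x → p * r * x - x ≡ (r - 1ℤ) * (p * x) + (p - 1ℤ) * x
      regroup = solve-∀

    absorption-suc n k = begin
      (b ^ suc k - 1ℤ) * (b ^ suc k * binom n (suc k) + x)
        ≡⟨ isolate (b ^ suc k) (binom n (suc k)) x ⟩
      b ^ suc k * ((b ^ suc k - 1ℤ) * binom n (suc k)) + (b ^ suc k - 1ℤ) * x
        ≡⟨ cong (λ y → b ^ suc k * y + (b ^ suc k - 1ℤ) * x) (absorption n k) ⟩
      b ^ suc k * ((b ^ (n ∸ k) - 1ℤ) * x) + (b ^ suc k - 1ℤ) * x
        ≡⟨ regroup (b ^ suc k) (b ^ (n ∸ k)) x ⟩
      b ^ suc k * b ^ (n ∸ k) * x - x
        ≡⟨ cong (_- x) (merge-powers n k n<k⇒binom≡0) ⟩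
      b ^ suc n * x - x
        ≡⟨ factor (b ^ suc n) x ⟩
      (b ^ suc n - 1ℤ) * x ∎
      where
      x = binom n k
      isolate : ∀ p y x → (p - 1ℤ) * (p * y + x) ≡ p * ((p - 1ℤ) * y) + (p - 1ℤ) * x
      isolate = solve-∀
      regroup : ∀ p r x → p * ((r - 1ℤ) * x) + (p - 1ℤ) * x ≡ p * r * x - x
      regroup = solve-∀
      factor : ∀ p x → p * x - x ≡ (p - 1ℤ) * x
      factor = solve-∀

    -- The dual Pascal rule. It differs from the defining one by `(b ^ suc k - 1) * binom n (suc k)`
    -- against `(b ^ (n ∸ k) - 1) * binom n k`, and these agree by `absorption`.
    binom-pascal : ∀ n k → binom (suc n) (suc k) ≡
                           binom n (suc k) + b ^ (n ∸ k) * binom n k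
    binom-pascal n k = begin
      b ^ suc k * y + x                        ≡⟨ isolate (b ^ suc k) y x ⟩
      y + ((b ^ suc k - 1ℤ) * y + x)           ≡⟨ cong (λ z → y + (z + x)) (absorption n k) ⟩
      y + ((b ^ (n ∸ k) - 1ℤ) * x + x)         ≡⟨ collect (b ^ (n ∸ k)) x y ⟩
      y + b ^ (n ∸ k) * x                      ∎
      where
      x = binom n k
      y = binom n (suc k)
      isolate : ∀ p y x → p * y + x ≡ y + ((p - 1ℤ) * y + x)
      isolate = solve-∀
      collect : ∀ r x y → y + ((r - 1ℤ) * x + x) ≡ y + r * x
      collect = solve-∀

    binom-diagonal : ∀ n → binom n n ≡ 1ℤ
    binom-diagonal zero    = refl
    binom-diagonal (suc n) = begin
      b ^ suc n * binom n (suc n) + binom n n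
        ≡⟨ cong₂ (λ x y → b ^ suc n * x + y) (n<k⇒binom≡0 (ℕ.n<1+n n)) (binom-diagonal n) ⟩
      b ^ suc n * 0ℤ + 1ℤ
        ≡⟨ cong (_+ 1ℤ) (ℤ.*-zeroʳ (b ^ suc n)) ⟩
      1ℤ ∎

    -- Reflection exchanges the two Pascal rules: the left side is expanded by the definition, the
    -- right side by `binom-pascal`, and the summands match crosswise by induction.
    binom-sym : ∀ k l → binom (k ℕ.+ l) k ≡ binom (k ℕ.+ l) l
    binom-sym zero    l = sym (binom-diagonal l)
    binom-sym (suc k) zero = begin
      binom (suc k ℕ.+ 0) (suc k) ≡⟨ cong (λ n → binom n (suc k)) (ℕ.+-identityʳ (suc k)) ⟩
      binom (suc k) (suc k)       ≡⟨ binom-diagonal (suc k) ⟩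
      1ℤ                          ∎
    binom-sym (suc k) (suc l) = begin
      b ^ suc k * binom (k ℕ.+ suc l) (suc k) + binom (k ℕ.+ suc l) k
        ≡⟨ cong₂ (λ x y → b ^ suc k * x + y) step₁ (binom-sym k (suc l)) ⟩
      b ^ suc k * binom (k ℕ.+ suc l) l + binom (k ℕ.+ suc l) (suc l)
        ≡⟨ cong (λ e → b ^ e * binom (k ℕ.+ suc l) l + binom (k ℕ.+ suc l) (suc l)) exponent ⟩
      b ^ (k ℕ.+ suc l ∸ l) * binom (k ℕ.+ suc l) l + binom (k ℕ.+ suc l) (suc l)
        ≡⟨ ℤ.+-comm (b ^ (k ℕ.+ suc l ∸ l) * binom (k ℕ.+ suc l) l) _ ⟩
      binom (k ℕ.+ suc l) (suc l) + b ^ (k ℕ.+ suc l ∸ l) * binom (k ℕ.+ suc l) l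
        ≡⟨ binom-pascal (k ℕ.+ suc l) l ⟨
      binom (suc k ℕ.+ suc l) (suc l) ∎
      where
      step₁ : binom (k ℕ.+ suc l) (suc k) ≡ binom (k ℕ.+ suc l) l
      step₁ = subst (λ n → binom n (suc k) ≡ binom n l) (sym (ℕ.+-suc k l)) (binom-sym (suc k) l)
      exponent : suc k ≡ k ℕ.+ suc l ∸ l
      exponent = sym (trans (cong (_∸ l) (ℕ.+-suc k l)) (ℕ.m+n∸n≡m (suc k) l))

  -- The sum over all pairs with `s + h = j`. Keeping `s = j - h` as a separate argument avoids
  -- truncated subtraction and allows a term to be split off at either end: `h = 0` by definition,
  -- `s = 0` by `conv-last`.
  conv : (ℕ → ℕ → ℤ) → ℕ → ℤ
  conv u zero    = u 0 0
  conv u (suc j) = u (suc j) 0 + conv (λ s h → u s (suc h)) j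

  conv-cong : ∀ {u v} j → (∀ s h → s ℕ.+ h ≡ j → u s h ≡ v s h) → conv u j ≡ conv v j
  conv-cong zero    u≗v = u≗v 0 0 refl
  conv-cong (suc j) u≗v = cong₂ _+_
    (u≗v (suc j) 0 (ℕ.+-identityʳ (suc j)))
    (conv-cong j λ s h s+h≡j → u≗v s (suc h) (trans (ℕ.+-suc s h) (cong suc s+h≡j)))

  conv-last : ∀ u j → conv u (suc j) ≡ conv (λ s h → u (suc s) h) j + u 0 (suc j)
  conv-last u zero    = refl
  conv-last u (suc j) = begin
    u (2 ℕ.+ j) 0 + conv (λ s h → u s (suc h)) (suc j)
      ≡⟨ cong (λ z → u (2 ℕ.+ j) 0 + z) (conv-last (λ s h → u s (suc h)) j) ⟩
    u (2 ℕ.+ j) 0 + (conv (λ s h → u (suc s) (suc h)) j + u 0 (2 ℕ.+ j))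
      ≡⟨ ℤ.+-assoc (u (2 ℕ.+ j) 0) _ _ ⟨
    u (2 ℕ.+ j) 0 + conv (λ s h → u (suc s) (suc h)) j + u 0 (2 ℕ.+ j) ∎

  conv-linear : ∀ x u y v j → conv (λ s h → x * u s h + y * v s h) j ≡ x * conv u j + y * conv v j
  conv-linear x u y v zero    = refl
  conv-linear x u y v (suc j) = trans
    (cong (λ z → x * u (suc j) 0 + y * v (suc j) 0 + z)
      (conv-linear x (λ s h → u s (suc h)) y (λ s h → v s (suc h)) j))
    (regroup x y (u (suc j) 0) (v (suc j) 0) (conv (λ s h → u s (suc h)) j) (conv (λ s h → v s (suc h)) j))
    where
    regroup : ∀ x y p r f g → x * p + y * r + (x * f + y * g) ≡ x * (p + f) + y * (r + g)
    regroup = solve-∀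

  conv-zero : ∀ {u} j → (∀ s h → s ℕ.+ h ≡ j → u s h ≡ 0ℤ) → conv u j ≡ 0ℤ
  conv-zero zero    u≗0 = u≗0 0 0 refl
  conv-zero (suc j) u≗0 = cong₂ _+_
    (u≗0 (suc j) 0 (ℕ.+-identityʳ (suc j)))
    (conv-zero j λ s h s+h≡j → u≗0 s (suc h) (trans (ℕ.+-suc s h) (cong suc s+h≡j)))

  -- Recurrences and closed forms for the eigenvalues.

  module Eigenvalues (b : ℤ) where
    open GaussianBinomial b

    -- The coefficient with lower index `d - j` in the definition of `Q` appears here reflected,
    -- with lower index `s = j - h`; thus `j` enters only through `s + h`.
    summand : ℕ → ℕ → ℕ → ℕ → ℤ
    summand d m s h = b ^ (s C 2 ℕ.+ h ℕ.* d) * binom (d ∸ h) s * binom m h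

    -- H d m j is Q_j(d - m).
    H : ℕ → ℕ → ℕ → ℤ
    H d m j = -1ℤ ^ j * conv (summand d m) j

    -- If `h ≤ d`, then `s` exceeds `d - h` and the first coefficient vanishes; if `h > d`, then `h`
    -- exceeds `m` and the second one does.
    summand≡0 : ∀ {d m} s h → d ℕ.< s ℕ.+ h → m ℕ.≤ d → summand d m s h ≡ 0ℤ
    summand≡0 {d} {m} s h d<s+h m≤d with h ℕ.≤? d
    ... | yes h≤d = begin
      b ^ (s C 2 ℕ.+ h ℕ.* d) * binom (d ∸ h) s * binom m h
        ≡⟨ cong (λ x → b ^ (s C 2 ℕ.+ h ℕ.* d) * x * binom m h) (n<k⇒binom≡0 d∸h<s) ⟩
      b ^ (s C 2 ℕ.+ h ℕ.* d) * 0ℤ * binom m h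
        ≡⟨ cong (_* binom m h) (ℤ.*-zeroʳ (b ^ (s C 2 ℕ.+ h ℕ.* d))) ⟩
      0ℤ ∎
      where
      d∸h<s : d ∸ h ℕ.< s
      d∸h<s = ℕ.+-cancelʳ-< h (d ∸ h) s (subst (ℕ._< s ℕ.+ h) (sym (ℕ.m∸n+n≡m h≤d)) d<s+h)
    ... | no h≰d = trans
      (cong (b ^ (s C 2 ℕ.+ h ℕ.* d) * binom (d ∸ h) s *_)
        (n<k⇒binom≡0 (ℕ.≤-<-trans m≤d (ℕ.≰⇒> h≰d))))
      (ℤ.*-zeroʳ (b ^ (s C 2 ℕ.+ h ℕ.* d) * binom (d ∸ h) s))

    H≡0 : ∀ {d m j} → d ℕ.< j → m ℕ.≤ d → H d m j ≡ 0ℤ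
    H≡0 {d} {m} {j} d<j m≤d = trans
      (cong (-1ℤ ^ j *_) (conv-zero j λ s h s+h≡j →
        summand≡0 s h (subst (d ℕ.<_) (sym s+h≡j) d<j) m≤d))
      (ℤ.*-zeroʳ (-1ℤ ^ j))

    -- Apply `binom-pascal` to the coefficient of `m`. Raising `h` and `d` by one contributes
    -- `d + h + 1` to the exponent and the Pascal rule contributes `m - h`; the total `d + m + 1` is
    -- independent of `h`, so the relation can be summed.
    summand-suc-m : ∀ d m s h → summand (suc d) (suc m) s (suc h) ≡
      1ℤ * summand (suc d) m s (suc h) + b ^ suc (d ℕ.+ m) * summand d m s h
    summand-suc-m d m s h = begin
      P * G * binom (suc m) (suc h)
        ≡⟨ cong (P * G *_) (binom-pascal m h) ⟩
      P * G * (binom m (suc h) + b ^ (m ∸ h) * binom m h)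
        ≡⟨ expand P G (binom m (suc h)) (b ^ (m ∸ h)) (binom m h) ⟩
      1ℤ * (P * G * binom m (suc h)) + G * (P * (b ^ (m ∸ h) * binom m h))
        ≡⟨ cong (λ x → 1ℤ * (P * G * binom m (suc h)) + G * x) powers ⟩
      1ℤ * (P * G * binom m (suc h)) + G * (b ^ suc (d ℕ.+ m) * (p * binom m h))
        ≡⟨ cong (λ x → 1ℤ * (P * G * binom m (suc h)) + x) (rotate G (b ^ suc (d ℕ.+ m)) p (binom m h)) ⟩
      1ℤ * (P * G * binom m (suc h)) + b ^ suc (d ℕ.+ m) * (p * G * binom m h) ∎
      where
      P = b ^ (s C 2 ℕ.+ suc h ℕ.* suc d)
      p = b ^ (s C 2 ℕ.+ h ℕ.* d)
      G = binom (d ∸ h) s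
      expand : ∀ p g x r y → p * g * (x + r * y) ≡ 1ℤ * (p * g * x) + g * (p * (r * y))
      expand = solve-∀
      rotate : ∀ g r p y → g * (r * (p * y)) ≡ r * (p * g * y)
      rotate = solve-∀
      powers : P * (b ^ (m ∸ h) * binom m h) ≡ b ^ suc (d ℕ.+ m) * (p * binom m h)
      powers = begin
        P * (b ^ (m ∸ h) * binom m h)
          ≡⟨ cong (λ e → b ^ e * (b ^ (m ∸ h) * binom m h)) (exponent (s C 2) h d) ⟩
        b ^ (d ℕ.+ (s C 2 ℕ.+ h ℕ.* d) ℕ.+ suc h) * (b ^ (m ∸ h) * binom m h)
          ≡⟨ cong (_* (b ^ (m ∸ h) * binom m h)) (split3 d (s C 2 ℕ.+ h ℕ.* d) (suc h)) ⟩
        b ^ d * p * b ^ suc h * (b ^ (m ∸ h) * binom m h)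
          ≡⟨ assoc (b ^ d) p (b ^ suc h) (b ^ (m ∸ h)) (binom m h) ⟩
        b ^ d * p * (b ^ suc h * b ^ (m ∸ h) * binom m h)
          ≡⟨ cong (b ^ d * p *_) (merge-powers m h n<k⇒binom≡0) ⟩
        b ^ d * p * (b ^ suc m * binom m h)
          ≡⟨ swap (b ^ d) p (b ^ suc m) (binom m h) ⟩
        b ^ d * b ^ suc m * (p * binom m h)
          ≡⟨ cong (_* (p * binom m h)) (ℤ.^-distribˡ-+-* b d (suc m)) ⟨
        b ^ (d ℕ.+ suc m) * (p * binom m h)
          ≡⟨ cong (λ e → b ^ e * (p * binom m h)) (ℕ.+-suc d m) ⟩
        b ^ suc (d ℕ.+ m) * (p * binom m h) ∎
        where
        split3 : ∀ x y z → b ^ (x ℕ.+ y ℕ.+ z) ≡ b ^ x * b ^ y * b ^ z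
        split3 x y z = trans (ℤ.^-distribˡ-+-* b (x ℕ.+ y) z)
                             (cong (_* b ^ z) (ℤ.^-distribˡ-+-* b x y))
        exponent : ∀ c h d → c ℕ.+ suc h ℕ.* suc d ≡ d ℕ.+ (c ℕ.+ h ℕ.* d) ℕ.+ suc h
        exponent = ℕ-Solver.solve-∀
        assoc : ∀ x p y r z → x * p * y * (r * z) ≡ x * p * (y * r * z)
        assoc = solve-∀
        swap : ∀ x p y z → x * p * (y * z) ≡ x * y * (p * z)
        swap = solve-∀

    H-suc-m : ∀ d m j →
      H (suc d) (suc m) (suc j) ≡ H (suc d) m (suc j) - b ^ suc (d ℕ.+ m) * H d m j
    H-suc-m d m j = begin
      -1ℤ * -1ℤ ^ j * (P + conv (λ s h → summand (suc d) (suc m) s (suc h)) j)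
        ≡⟨ cong (λ x → -1ℤ * -1ℤ ^ j * (P + x)) tail ⟩
      -1ℤ * -1ℤ ^ j * (P + (1ℤ * rest + b ^ suc (d ℕ.+ m) * conv (summand d m) j))
        ≡⟨ regroup (-1ℤ ^ j) P rest (b ^ suc (d ℕ.+ m)) (conv (summand d m) j) ⟩
      H (suc d) m (suc j) - b ^ suc (d ℕ.+ m) * H d m j ∎
      where
      -- The term `h = 0` is the same for `m` and `suc m`, because `binom _ 0` is 1.
      P = summand (suc d) m (suc j) 0
      rest = conv (λ s h → summand (suc d) m s (suc h)) j
      tail : conv (λ s h → summand (suc d) (suc m) s (suc h)) j ≡
             1ℤ * rest + b ^ suc (d ℕ.+ m) * conv (summand d m) j
      tail = trans
        (conv-cong j λ s h _ → summand-suc-m d m s h)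
        (conv-linear 1ℤ (λ s h → summand (suc d) m s (suc h)) (b ^ suc (d ℕ.+ m)) (summand d m) j)
      regroup : ∀ σ x r p y → -1ℤ * σ * (x + (1ℤ * r + p * y)) ≡
                -1ℤ * σ * (x + r) - p * (σ * y)
      regroup = solve-∀

    suc-C-2 : ∀ s → suc s C 2 ≡ s ℕ.+ s C 2
    suc-C-2 s = trans (sym (nCk+nC[k+1]≡[n+1]C[k+1] s 1)) (cong (ℕ._+ s C 2) (nC1≡n s))

    -- The defining Pascal rule for the coefficient of `suc d ∸ h`. Since `suc s C 2` is
    -- `s + s C 2`, the extra powers of `b` depend only on `s + h`, which is constant along the sum.
    summand-suc-d : ∀ {d m} → m ℕ.≤ d → ∀ s h → summand (suc d) m (suc s) h ≡
      b ^ suc (s ℕ.+ h) * summand d m (suc s) h + b ^ (s ℕ.+ h) * summand d m s h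
    summand-suc-d {d} {m} m≤d s h with h ℕ.≤? d
    ... | yes h≤d = begin
      b ^ (suc s C 2 ℕ.+ h ℕ.* suc d) * binom (suc d ∸ h) (suc s) * binom m h
        ≡⟨ cong₂ (λ x y → x * y * binom m h) top (cong (λ n → binom n (suc s)) (ℕ.+-∸-assoc 1 h≤d)) ⟩
      r * p * (b * b ^ s * x + y) * binom m h
        ≡⟨ regroup r p (b ^ s) x y (binom m h) b ⟩
      b * r * (b ^ s * p * x * binom m h) + r * (p * y * binom m h)
        ≡⟨ cong (λ z → b * r * (z * x * binom m h) + r * (p * y * binom m h)) low ⟨
      b * r * summand d m (suc s) h + r * summand d m s h ∎
      where
      r = b ^ (s ℕ.+ h)
      p = b ^ (s C 2 ℕ.+ h ℕ.* d)
      x = binom (d ∸ h) (suc s)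
      y = binom (d ∸ h) s
      exponent : ∀ s c h d → s ℕ.+ c ℕ.+ h ℕ.* suc d ≡ s ℕ.+ h ℕ.+ (c ℕ.+ h ℕ.* d)
      exponent = ℕ-Solver.solve-∀
      top : b ^ (suc s C 2 ℕ.+ h ℕ.* suc d) ≡ r * p
      top = trans
        (cong (b ^_) (trans (cong (ℕ._+ h ℕ.* suc d) (suc-C-2 s)) (exponent s (s C 2) h d)))
        (ℤ.^-distribˡ-+-* b (s ℕ.+ h) (s C 2 ℕ.+ h ℕ.* d))
      low : b ^ (suc s C 2 ℕ.+ h ℕ.* d) ≡ b ^ s * p
      low = trans
        (cong (b ^_) (trans (cong (ℕ._+ h ℕ.* d) (suc-C-2 s)) (ℕ.+-assoc s (s C 2) (h ℕ.* d))))
        (ℤ.^-distribˡ-+-* b s (s C 2 ℕ.+ h ℕ.* d))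
      regroup : ∀ r p q x y z b → r * p * (b * q * x + y) * z ≡
                b * r * (q * p * x * z) + r * (p * y * z)
      regroup = solve-∀
    ... | no h≰d = trans
      (vanish (b ^ (suc s C 2 ℕ.+ h ℕ.* suc d) * binom (suc d ∸ h) (suc s)))
      (sym (cong₂ _+_
        (trans (cong (b ^ suc (s ℕ.+ h) *_)
                 (vanish (b ^ (suc s C 2 ℕ.+ h ℕ.* d) * binom (d ∸ h) (suc s))))
               (ℤ.*-zeroʳ (b ^ suc (s ℕ.+ h))))
        (trans (cong (b ^ (s ℕ.+ h) *_)
                 (vanish (b ^ (s C 2 ℕ.+ h ℕ.* d) * binom (d ∸ h) s)))
               (ℤ.*-zeroʳ (b ^ (s ℕ.+ h))))))
      where
      vanish : ∀ x → x * binom m h ≡ 0ℤ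
      vanish x = trans (cong (x *_) (n<k⇒binom≡0 (ℕ.≤-<-trans m≤d (ℕ.≰⇒> h≰d)))) (ℤ.*-zeroʳ x)

    H-suc-d : ∀ {d m} → m ℕ.≤ d → ∀ j →
      H (suc d) m (suc j) ≡ b ^ suc j * H d m (suc j) - b ^ j * H d m j
    H-suc-d {d} {m} m≤d j = begin
      -1ℤ * σ * conv (summand (suc d) m) (suc j)
        ≡⟨ cong (-1ℤ * σ *_) (conv-last (summand (suc d) m) j) ⟩
      -1ℤ * σ * (conv (λ s h → summand (suc d) m (suc s) h) j + summand (suc d) m 0 (suc j))
        ≡⟨ cong₂ (λ x y → -1ℤ * σ * (x + y)) body end ⟩
      -1ℤ * σ * (b ^ suc j * conv (λ s h → summand d m (suc s) h) j + b ^ j * conv (summand d m) j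
                 + b ^ suc j * summand d m 0 (suc j))
        ≡⟨ regroup σ (b ^ suc j) (conv (λ s h → summand d m (suc s) h) j)
             (b ^ j * conv (summand d m) j) (summand d m 0 (suc j)) ⟩
      b ^ suc j * (-1ℤ * σ * (conv (λ s h → summand d m (suc s) h) j + summand d m 0 (suc j)))
        - σ * (b ^ j * conv (summand d m) j)
        ≡⟨ cong₂ (λ x y → b ^ suc j * (-1ℤ * σ * x) - y)
             (sym (conv-last (summand d m) j)) (swap σ (b ^ j) (conv (summand d m) j)) ⟩
      b ^ suc j * H d m (suc j) - b ^ j * H d m j ∎
      where
      σ = -1ℤ ^ j
      body : conv (λ s h → summand (suc d) m (suc s) h) j ≡
             b ^ suc j * conv (λ s h → summand d m (suc s) h) j + b ^ j * conv (summand d m) j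
      body = trans
        (conv-cong j λ s h s+h≡j → trans (summand-suc-d m≤d s h)
          (cong (λ e → b ^ suc e * summand d m (suc s) h + b ^ e * summand d m s h) s+h≡j))
        (conv-linear (b ^ suc j) (λ s h → summand d m (suc s) h) (b ^ j) (summand d m) j)
      -- The term `s = 0` is not split by Pascal. It acquires the same factor `b ^ suc j` and so
      -- completes the sum for `H d m (suc j)`.
      end : summand (suc d) m 0 (suc j) ≡ b ^ suc j * summand d m 0 (suc j)
      end = begin
        b ^ (suc j ℕ.* suc d) * 1ℤ * binom m (suc j)
          ≡⟨ cong (λ x → x * 1ℤ * binom m (suc j))
               (trans (cong (b ^_) (ℕ.*-suc (suc j) d)) (ℤ.^-distribˡ-+-* b (suc j) (suc j ℕ.* d))) ⟩
        b ^ suc j * b ^ (suc j ℕ.* d) * 1ℤ * binom m (suc j)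
          ≡⟨ assoc (b ^ suc j) (b ^ (suc j ℕ.* d)) (binom m (suc j)) ⟩
        b ^ suc j * summand d m 0 (suc j) ∎
        where
        assoc : ∀ x y z → x * y * 1ℤ * z ≡ x * (y * 1ℤ * z)
        assoc = solve-∀
      regroup : ∀ σ p x y z → -1ℤ * σ * (p * x + y + p * z) ≡ p * (-1ℤ * σ * (x + z)) - σ * y
      regroup = solve-∀
      swap : ∀ σ p x → σ * (p * x) ≡ p * (σ * x)
      swap = solve-∀

    -- The decomposition on which all estimates rest: the first part equals `H (suc d) m (suc j)`,
    -- the second is the dominant one.
    H-suc-d-suc-m : ∀ {d m} → m ℕ.≤ d → ∀ j → H (suc d) (suc m) (suc j) ≡
      b ^ j * (b * H d m (suc j) - H d m j) - b ^ suc (d ℕ.+ m) * H d m j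
    H-suc-d-suc-m {d} {m} m≤d j = begin
      H (suc d) (suc m) (suc j)
        ≡⟨ H-suc-m d m j ⟩
      H (suc d) m (suc j) - b ^ suc (d ℕ.+ m) * H d m j
        ≡⟨ cong (_- b ^ suc (d ℕ.+ m) * H d m j) (H-suc-d m≤d j) ⟩
      b ^ suc j * H d m (suc j) - b ^ j * H d m j - b ^ suc (d ℕ.+ m) * H d m j
        ≡⟨ cong (_- b ^ suc (d ℕ.+ m) * H d m j) (factor b (b ^ j) (H d m (suc j)) (H d m j)) ⟩
      b ^ j * (b * H d m (suc j) - H d m j) - b ^ suc (d ℕ.+ m) * H d m j ∎
      where
      factor : ∀ b p x y → b * p * x - p * y ≡ p * (b * x - y)
      factor = solve-∀

    -- The case `j = 1` in closed form: for `j = 1` the recurrences involve only `H d m 1` and the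
    -- constant `H d m 0 = 1`, so induction on `d` solves them.
    H-first : ∀ {d m} → m ℕ.≤ d → (b - 1ℤ) * H d m 1 ≡ 1ℤ - b ^ (d ℕ.+ m)
    H-first {zero} {zero} _ = trans
      (cong ((b - 1ℤ) *_) (H≡0 {0} {0} {1} ℕ.z<s ℕ.z≤n)) (ℤ.*-zeroʳ (b - 1ℤ))
    H-first {suc d} {zero} _ = begin
      (b - 1ℤ) * H (suc d) 0 1
        ≡⟨ cong ((b - 1ℤ) *_) (H-suc-d {d} {0} ℕ.z≤n 0) ⟩
      (b - 1ℤ) * (b * 1ℤ * H d 0 1 - 1ℤ)
        ≡⟨ isolate b (H d 0 1) ⟩
      b * ((b - 1ℤ) * H d 0 1) - (b - 1ℤ)
        ≡⟨ cong (λ x → b * x - (b - 1ℤ)) (H-first {d} {0} ℕ.z≤n) ⟩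
      b * (1ℤ - b ^ (d ℕ.+ 0)) - (b - 1ℤ)
        ≡⟨ collect b (b ^ (d ℕ.+ 0)) ⟩
      1ℤ - b ^ suc (d ℕ.+ 0) ∎
      where
      isolate : ∀ b x → (b - 1ℤ) * (b * 1ℤ * x - 1ℤ) ≡ b * ((b - 1ℤ) * x) - (b - 1ℤ)
      isolate = solve-∀
      collect : ∀ b p → b * (1ℤ - p) - (b - 1ℤ) ≡ 1ℤ - b * p
      collect = solve-∀
    H-first {suc d} {suc m} (ℕ.s≤s m≤d) = begin
      (b - 1ℤ) * H (suc d) (suc m) 1
        ≡⟨ cong ((b - 1ℤ) *_) (H-suc-d-suc-m m≤d 0) ⟩
      (b - 1ℤ) * (1ℤ * (b * H d m 1 - 1ℤ) - b * p * 1ℤ)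
        ≡⟨ isolate b (H d m 1) p ⟩
      b * ((b - 1ℤ) * H d m 1) - (b - 1ℤ) * (1ℤ + b * p)
        ≡⟨ cong (λ x → b * x - (b - 1ℤ) * (1ℤ + b * p)) (H-first m≤d) ⟩
      b * (1ℤ - p) - (b - 1ℤ) * (1ℤ + b * p)
        ≡⟨ collect b p ⟩
      1ℤ - b * (b * p)
        ≡⟨ cong (λ e → 1ℤ - b ^ suc e) (ℕ.+-suc d m) ⟨
      1ℤ - b ^ (suc d ℕ.+ suc m) ∎
      where
      p = b ^ (d ℕ.+ m)
      isolate : ∀ b x p → (b - 1ℤ) * (1ℤ * (b * x - 1ℤ) - b * p * 1ℤ) ≡
                b * ((b - 1ℤ) * x) - (b - 1ℤ) * (1ℤ + b * p)
      isolate = solve-∀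
      collect : ∀ b p → b * (1ℤ - p) - (b - 1ℤ) * (1ℤ + b * p) ≡ 1ℤ - b * (b * p)
      collect = solve-∀

    -- For `m = 0` only `h = 0` contributes, so `H d 0 j` is, up to sign, `b ^ (j C 2) * binom d j`;
    -- this is the quotient of consecutive values. The induction on `d` uses the relation at `suc j`
    -- to remove `y₂` and the one at `j` to bring in `y₀`.
    H-ratio : ∀ d j → (b ^ suc j - 1ℤ) * H d 0 (suc j) ≡ (b ^ j - b ^ d) * H d 0 j
    H-ratio zero j = trans
      (trans (cong ((b ^ suc j - 1ℤ) *_) (H≡0 {0} {0} {suc j} ℕ.z<s ℕ.z≤n)) (ℤ.*-zeroʳ (b ^ suc j - 1ℤ)))
      (sym (vanish j))
      where
      vanish : ∀ j → (b ^ j - 1ℤ) * H 0 0 j ≡ 0ℤ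
      vanish zero    = refl
      vanish (suc j) = trans
        (cong ((b ^ suc j - 1ℤ) *_) (H≡0 {0} {0} {suc j} ℕ.z<s ℕ.z≤n)) (ℤ.*-zeroʳ (b ^ suc j - 1ℤ))
    H-ratio (suc d) zero = begin
      (b * 1ℤ - 1ℤ) * H (suc d) 0 1     ≡⟨ cong (λ x → (x - 1ℤ) * H (suc d) 0 1) (ℤ.*-identityʳ b) ⟩
      (b - 1ℤ) * H (suc d) 0 1          ≡⟨ H-first {suc d} {0} ℕ.z≤n ⟩
      1ℤ - b ^ (suc d ℕ.+ 0)            ≡⟨ cong (λ e → 1ℤ - b ^ e) (ℕ.+-identityʳ (suc d)) ⟩
      1ℤ - b ^ suc d                    ≡⟨ ℤ.*-identityʳ (1ℤ - b ^ suc d) ⟨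
      (1ℤ - b ^ suc d) * 1ℤ             ∎
    H-ratio (suc d) (suc j) = begin
      (b * (b * p) - 1ℤ) * H (suc d) 0 (2 ℕ.+ j)
        ≡⟨ cong ((b * (b * p) - 1ℤ) *_) (H-suc-d {d} {0} ℕ.z≤n (suc j)) ⟩
      (b * (b * p) - 1ℤ) * (b * (b * p) * y₂ - b * p * y₁)
        ≡⟨ isolate₁ b p y₁ y₂ ⟩
      b * (b * p) * ((b * (b * p) - 1ℤ) * y₂) - (b * (b * p) - 1ℤ) * (b * p * y₁)
        ≡⟨ cong (λ x → b * (b * p) * x - (b * (b * p) - 1ℤ) * (b * p * y₁)) (H-ratio d (suc j)) ⟩
      b * (b * p) * ((b * p - D) * y₁) - (b * (b * p) - 1ℤ) * (b * p * y₁)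
        ≡⟨ rearrange b p D y₁ ⟩
      (b * p - b * D) * (b * p * y₁) - b * p * ((b * p - 1ℤ) * y₁)
        ≡⟨ cong (λ x → (b * p - b * D) * (b * p * y₁) - b * p * x) (H-ratio d j) ⟩
      (b * p - b * D) * (b * p * y₁) - b * p * ((p - D) * y₀)
        ≡⟨ isolate₂ b p D y₀ y₁ ⟩
      (b * p - b * D) * (b * p * y₁ - p * y₀)
        ≡⟨ cong ((b * p - b * D) *_) (H-suc-d {d} {0} ℕ.z≤n j) ⟨
      (b * p - b * D) * H (suc d) 0 (suc j) ∎
      where
      p  = b ^ j
      D  = b ^ d
      y₀ = H d 0 j
      y₁ = H d 0 (suc j)
      y₂ = H d 0 (2 ℕ.+ j)
      isolate₁ : ∀ b p y₁ y₂ → (b * (b * p) - 1ℤ) * (b * (b * p) * y₂ - b * p * y₁) ≡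
                 b * (b * p) * ((b * (b * p) - 1ℤ) * y₂) - (b * (b * p) - 1ℤ) * (b * p * y₁)
      isolate₁ = solve-∀
      rearrange : ∀ b p D y₁ →
                  b * (b * p) * ((b * p - D) * y₁) - (b * (b * p) - 1ℤ) * (b * p * y₁) ≡
                  (b * p - b * D) * (b * p * y₁) - b * p * ((b * p - 1ℤ) * y₁)
      rearrange = solve-∀
      isolate₂ : ∀ b p D y₀ y₁ → (b * p - b * D) * (b * p * y₁) - b * p * ((p - D) * y₀) ≡
                 (b * p - b * D) * (b * p * y₁ - p * y₀)
      isolate₂ = solve-∀

-- Integrality of the rational numbers `Q q d j i`.

module Integrality where
  open import Data.Integer.Base hiding (suc; _≤_; _*_; _+_; _-_; _^_; NonZero)
  open import Data.Nat.Base as ℕ using (ℕ; zero; suc; _∸_; _≤_; NonTrivial; NonZero)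
  open import Data.Rational.Base using (ℚ; _*_; _÷_; _+_; 1/_)
  open ≡-Reasoning
  open Recurrences

  fromℤ-homo-+ : ∀ x y → fromℤ (x ℤ.+ y) ≡ fromℤ x + fromℤ y
  fromℤ-homo-+ x y = ℚ.toℚᵘ-injective (ℚᵘ.≃-trans
    (ℚᵘ.*≡* (cong (ℤ._* 1ℤ) (sym (cong₂ ℤ._+_ (ℤ.*-identityʳ x) (ℤ.*-identityʳ y)))))
    (ℚᵘ.≃-sym (ℚ.toℚᵘ-homo-+ (fromℤ x) (fromℤ y))))

  fromℤ-homo-* : ∀ x y → fromℤ (x ℤ.* y) ≡ fromℤ x * fromℤ y
  fromℤ-homo-* x y = ℚ.toℚᵘ-injective (ℚᵘ.≃-trans (ℚᵘ.*≡* refl)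
    (ℚᵘ.≃-sym (ℚ.toℚᵘ-homo-* (fromℤ x) (fromℤ y))))

  fromℤ-mono-≤ : ∀ {x y} → x ℤ.≤ y → fromℤ x ℚ.≤ fromℤ y
  fromℤ-mono-≤ {x} {y} x≤y = ℚ.*≤* (subst₂ ℤ._≤_ (sym (ℤ.*-identityʳ x)) (sym (ℤ.*-identityʳ y)) x≤y)

  fromℤ-abs-mono-< : ∀ {x y} → ∣ x ∣ ℕ.< ∣ y ∣ → ℚ.∣ fromℤ x ∣ ℚ.< ℚ.∣ fromℤ y ∣
  fromℤ-abs-mono-< {x} {y} ∣x∣<∣y∣ = ℚ.*<* (subst₂ ℤ._<_
    (sym (ℤ.*-identityʳ (+ ∣ x ∣))) (sym (ℤ.*-identityʳ (+ ∣ y ∣))) (+<+ ∣x∣<∣y∣))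

  ÷-*-cancel : ∀ x y .{{_ : ℚ.NonZero y}} {c e} → y * c ≡ x * e → x ÷ y * e ≡ c
  ÷-*-cancel x y {c} {e} yc≡xe = begin
    x * 1/ y * e   ≡⟨ cong (_* e) (ℚ.*-comm x (1/ y)) ⟩
    1/ y * x * e   ≡⟨ ℚ.*-assoc (1/ y) x e ⟩
    1/ y * (x * e) ≡⟨ cong (1/ y *_) yc≡xe ⟨
    1/ y * (y * c) ≡⟨ ℚ.*-assoc (1/ y) y c ⟨
    1/ y * y * c   ≡⟨ cong (_* c) (ℚ.*-inverseˡ y) ⟩
    ℚ.1ℚ * c       ≡⟨ ℚ.*-identityˡ c ⟩
    c              ∎

  module _ (b : ℤ) {{_ : NonTrivial ∣ b ∣}} where
    open GaussianBinomial b
    open Eigenvalues b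

    pow-pred : ℕ → ℤ
    pow-pred n = b ℤ.^ n ℤ.- 1ℤ

    -- Without its factor for `h = 0`, the product for `suc a` and `suc k` is the product for `a`
    -- and `k`. Hence `absorption-suc` is the induction step.
    gaussian≡binom : ∀ a k → gaussian b a k ≡ fromℤ (binom a k)
    gaussian≡binom a       zero    = refl
    -- The leading numerator is `b ^ 0 - 1`, which is 0.
    gaussian≡binom zero    (suc k) = trans
      (cong (_* tail) (ℚ.*-zeroˡ (1/_ (fromℤ (pow-pred (suc k))) {{b^n-1≢0 b (suc k)}})))
      (ℚ.*-zeroˡ tail)
      where
      tail : ℚ
      tail = product {k} λ h →
        (fromℤ (pow-pred 0) ÷ fromℤ (pow-pred (k ∸ toℕ h))) {{b^n-1≢0 b (k ∸ toℕ h) {{k∸h≢0 h}}}}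
    gaussian≡binom (suc a) (suc k) = trans
      (cong (λ x → (fromℤ (pow-pred (suc a)) ÷ fromℤ (pow-pred (suc k))) {{b^n-1≢0 b (suc k)}} * x) (gaussian≡binom a k))
      (÷-*-cancel (fromℤ (pow-pred (suc a))) (fromℤ (pow-pred (suc k))) {{b^n-1≢0 b (suc k)}} (begin
        fromℤ (pow-pred (suc k)) * fromℤ (binom (suc a) (suc k)) ≡⟨ fromℤ-homo-* (pow-pred (suc k)) (binom (suc a) (suc k)) ⟨
        fromℤ ((pow-pred (suc k)) ℤ.* binom (suc a) (suc k))     ≡⟨ cong fromℤ (absorption-suc a k) ⟩
        fromℤ ((pow-pred (suc a)) ℤ.* binom a k)                 ≡⟨ fromℤ-homo-* (pow-pred (suc a)) (binom a k) ⟩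
        fromℤ (pow-pred (suc a)) * fromℤ (binom a k)             ∎))

    sum≡conv : ∀ w j → sum {suc j} (λ h → fromℤ (w (j ∸ toℕ h) (toℕ h))) ≡ fromℤ (conv w j)
    sum≡conv w zero    = ℚ.+-identityʳ (fromℤ (w 0 0))
    sum≡conv w (suc j) = begin
      fromℤ (w (suc j) 0) + sum {suc j} (λ h → fromℤ (w (j ∸ toℕ h) (suc (toℕ h))))
        ≡⟨ cong (λ x → fromℤ (w (suc j) 0) + x) (sum≡conv (λ s h → w s (suc h)) j) ⟩
      fromℤ (w (suc j) 0) + fromℤ (conv (λ s h → w s (suc h)) j)
        ≡⟨ fromℤ-homo-+ (w (suc j) 0) _ ⟨
      fromℤ (conv w (suc j)) ∎

    binom-reflect : ∀ {d j h} → h ≤ j → j ≤ d → binom (d ∸ h) (d ∸ j) ≡ binom (d ∸ h) (j ∸ h)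
    binom-reflect {d} {j} {h} h≤j j≤d =
      subst (λ n → binom n (d ∸ j) ≡ binom n (j ∸ h)) (begin
        d ∸ j ℕ.+ (j ∸ h) ≡⟨ ℕ.+-∸-assoc (d ∸ j) h≤j ⟨
        d ∸ j ℕ.+ j ∸ h   ≡⟨ cong (_∸ h) (ℕ.m∸n+n≡m j≤d) ⟩
        d ∸ h             ∎) (binom-sym (d ∸ j) (j ∸ h))

    term : ℕ → ℕ → ℕ → ∀ {n} → Fin n → ℚ
    term d j i h = fromℤ (b ℤ.^ ((j ∸ toℕ h) C 2 ℕ.+ toℕ h ℕ.* d))
                   * gaussian b (d ∸ toℕ h) (d ∸ j) * gaussian b (d ∸ i) (toℕ h)

    term≡summand : ∀ {d j} i → j ≤ d → (h : Fin (suc j)) → term d j i h ≡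
      fromℤ (summand d (d ∸ i) (j ∸ toℕ h) (toℕ h))
    term≡summand {d} {j} i j≤d h' = begin
      fromℤ P * gaussian b (d ∸ h) (d ∸ j) * gaussian b (d ∸ i) h
        ≡⟨ cong₂ (λ x y → fromℤ P * x * y)
             (trans (gaussian≡binom (d ∸ h) (d ∸ j)) (cong fromℤ (binom-reflect (toℕ≤pred[n] h') j≤d)))
             (gaussian≡binom (d ∸ i) h) ⟩
      fromℤ P * fromℤ G * fromℤ (binom (d ∸ i) h)
        ≡⟨ cong (_* fromℤ (binom (d ∸ i) h)) (fromℤ-homo-* P G) ⟨
      fromℤ (P ℤ.* G) * fromℤ (binom (d ∸ i) h)
        ≡⟨ fromℤ-homo-* (P ℤ.* G) (binom (d ∸ i) h) ⟨
      fromℤ (summand d (d ∸ i) (j ∸ h) h) ∎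
      where
      h = toℕ h'
      P = b ℤ.^ ((j ∸ h) C 2 ℕ.+ h ℕ.* d)
      G = binom (d ∸ h) (j ∸ h)

  -- Allows every inequality to be proved in the integers and carried over by `fromℤ`.
  Q≡H : ∀ q {{_ : NonTrivial q}} {d j} i → j ≤ d →
        Q q d j i ≡ fromℤ (Eigenvalues.H (- (+ q)) d (d ∸ i) j)
  Q≡H q {d} {j} i j≤d = begin
    fromℤ (-1ℤ ℤ.^ j) * sum {suc j} (term b {{b-nonTrivial}} d j i)
      ≡⟨ cong (λ x → fromℤ (-1ℤ ℤ.^ j) * x) (trans
           (sum-cong-≗ (term≡summand b {{b-nonTrivial}} i j≤d))
           (sum≡conv b {{b-nonTrivial}} (summand d (d ∸ i)) j)) ⟩
    fromℤ (-1ℤ ℤ.^ j) * fromℤ (conv (summand d (d ∸ i)) j)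
      ≡⟨ fromℤ-homo-* (-1ℤ ℤ.^ j) (conv (summand d (d ∸ i)) j) ⟨
    fromℤ (H d (d ∸ i) j) ∎
    where
    b = - (+ q)
    b-nonTrivial = ∣-q∣-nonTrivial q
    open Eigenvalues b

-- Signs of sums and products of integers.

module Signs where
  open import Data.Integer.Base using (ℤ; +_; -[1+_]; -_; _+_; _-_; _*_; -≤-; -≤+; ∣_∣; sign)
  open import Data.Nat.Base as ℕ using (zero; suc)

  -- As `sign` assigns `+` to 0, the bound has to be strict: a negative `x` must not be cancelled
  -- completely.
  sign-absorb : ∀ x e → ∣ e ∣ ℕ.< ∣ x ∣ → sign (x + e) ≡ sign x
  sign-absorb (+ n)     (+ k)     _ = refl
  sign-absorb (+ n)     -[1+ k ]  k<n = cong sign (ℤ.⊖-≥ (ℕ.<⇒≤ k<n))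
  sign-absorb -[1+ n ]  (+ k)     k≤n = trans (cong sign (ℤ.⊖-< k≤n)) (negative (ℕ.m<n⇒0<n∸m k≤n))
    where
    negative : ∀ {k} → 0 ℕ.< k → sign (- (+ k)) ≡ Sign.-
    negative {suc k} _ = refl
  sign-absorb -[1+ n ]  -[1+ k ]  _ = refl

  sign-neg : ∀ x → 0 ℕ.< ∣ x ∣ → sign (- x) ≡ Sign.opposite (sign x)
  sign-neg (+ suc n)  _ = refl
  sign-neg -[1+ n ]   _ = refl

  sign-minus : ∀ e x → ∣ e ∣ ℕ.< ∣ x ∣ → sign (e - x) ≡ Sign.opposite (sign x)
  sign-minus e x e<x = trans
    (cong sign (ℤ.+-comm e (- x)))
    (trans (sign-absorb (- x) e (subst (∣ e ∣ ℕ.<_) (sym (ℤ.∣-i∣≡∣i∣ x)) e<x))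
           (sign-neg x (ℕ.≤-<-trans ℕ.z≤n e<x)))

  sign-homo-* : ∀ x y → 0 ℕ.< ∣ x ∣ → 0 ℕ.< ∣ y ∣ → sign (x * y) ≡ sign x Sign.* sign y
  sign-homo-* x y 0<x 0<y = ℤ.sign-* x y
    {{ℕ.>-nonZero (subst (0 ℕ.<_) (sym (ℤ.abs-* x y)) (ℕ.*-mono-< 0<x 0<y))}}

  negative⇒≤ : ∀ {x y} → sign x ≡ Sign.- → ∣ y ∣ ℕ.≤ ∣ x ∣ → x ℤ.≤ y
  negative⇒≤ {x = -[1+ _ ]} {+ _}      _ _ = -≤+
  negative⇒≤ {x = -[1+ _ ]} { -[1+ _ ]} _ (ℕ.s≤s n≤m) = -≤- n≤m

  opposite-signs⇒≤ : ∀ {x y} → sign x ≡ Sign.- → sign y ≡ Sign.+ → x ℤ.≤ y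
  opposite-signs⇒≤ {x = -[1+ _ ]} {+ _} _ _ = -≤+

open import Data.Nat.Base using (ℕ; zero; suc; _+_; _*_; _∸_; _≤_; _<_; z≤n; s≤s; NonTrivial)
open import Data.Nat.Divisibility using (_∣_; _∤_; divides)
open import Data.Product.Base using (_×_)

-- Growth estimates for the absolute values of the eigenvalues.

module Estimates (q : ℕ) (4≤q : 4 ≤ q) where
  open import Data.Integer.Base using (ℤ; +_; -_; 0ℤ; 1ℤ; ∣_∣)
  open import Data.Nat.Base hiding (∣_-_∣)
  open ℕ.≤-Reasoning

  b : ℤ
  b = - (+ q)

  open Recurrences.Eigenvalues b

  0<q : 0 < q
  0<q = ℕ.≤-trans (s≤s z≤n) 4≤q

  instance
    q≢0 : NonZero q
    q≢0 = >-nonZero 0<q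

  ∣b^n∣≡q^n : ∀ n → ∣ b ℤ.^ n ∣ ≡ q ^ n
  ∣b^n∣≡q^n zero    = refl
  ∣b^n∣≡q^n (suc n) = trans (ℤ.abs-* b (b ℤ.^ n)) (cong₂ _*_ (ℤ.∣-i∣≡∣i∣ (+ q)) (∣b^n∣≡q^n n))

  ∣b^n*x∣ : ∀ n x → ∣ b ℤ.^ n ℤ.* x ∣ ≡ q ^ n * ∣ x ∣
  ∣b^n*x∣ n x = trans (ℤ.abs-* (b ℤ.^ n) x) (cong (_* ∣ x ∣) (∣b^n∣≡q^n n))

  ∣b-1∣≡q+1 : ∣ b ℤ.- 1ℤ ∣ ≡ suc q
  ∣b-1∣≡q+1 = begin-equality
    ∣ - (+ q) ℤ.+ - 1ℤ ∣ ≡⟨ cong ∣_∣ (ℤ.neg-distrib-+ (+ q) 1ℤ) ⟨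
    ∣ - (+ (q + 1)) ∣    ≡⟨ ℤ.∣-i∣≡∣i∣ (+ (q + 1)) ⟩
    q + 1                ≡⟨ ℕ.+-comm q 1 ⟩
    suc q                ∎

  4*q^m≤q^n : ∀ {m n} → m < n → 4 * q ^ m ≤ q ^ n
  4*q^m≤q^n {m} m<n = ℕ.≤-trans (ℕ.*-monoˡ-≤ (q ^ m) 4≤q) (ℕ.^-monoʳ-≤ q m<n)

  0<q^n : ∀ n → 0 < q ^ n
  0<q^n = ℕ.m^n>0 q

  -- The bound 3/2 q^(d+m-j-1) for the ratio of consecutive values, with denominators cleared.
  UpperBound : ℕ → ℕ → ℕ → Set
  UpperBound d m j = 2 * q ^ suc j * ∣ H d m (suc j) ∣ ≤ 3 * q ^ (d + m) * ∣ H d m j ∣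

  -- By the triangle inequality this gives `2 * ∣ E ∣ < ∣ M ∣` for the two parts `E` and `M` of
  -- `H-suc-d-suc-m`.
  Dominated : ℕ → ℕ → ℕ → Set
  Dominated d m j = 2 * (q ^ j * (q * ∣ H d m (suc j) ∣ + ∣ H d m j ∣)) < q ^ suc (d + m) * ∣ H d m j ∣

  0<* : ∀ {x y} → 0 < x → 0 < y → 0 < x * y
  0<* = ℕ.*-mono-<

  -- For `j < d` the upper bound contributes at most `3 * T * a`, and the remaining `2 * (P * a)` is
  -- less than `4 * P * a ≤ T * a`. The total stays below `4 * T * a`, which is at most `q * T * a`.
  dominated : ∀ {d m j} → m ≤ d → j ≤ d → 0 < ∣ H d m j ∣ → (j < d → UpperBound d m j) → Dominated d m j
  dominated {d} {m} {j} m≤d j≤d 0<a upper with ℕ.m≤n⇒m<n∨m≡n j≤d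
  ... | inj₁ j<d = begin-strict
    2 * (P * (q * c + a))      ≡⟨ expand P q c a ⟩
    2 * (q * P) * c + 2 * (P * a)
      <⟨ ℕ.+-mono-≤-< (upper j<d) (ℕ.*-monoˡ-< (P * a) {{>-nonZero (0<* (0<q^n j) 0<a)}} {2} {4} (s≤s (s≤s (s≤s z≤n)))) ⟩
    3 * T * a + 4 * (P * a)    ≡⟨ regroup T a P ⟩
    (3 * T + 4 * P) * a        ≤⟨ ℕ.*-monoˡ-≤ a (ℕ.+-monoʳ-≤ (3 * T) (4*q^m≤q^n (ℕ.<-≤-trans j<d (ℕ.m≤m+n d m)))) ⟩
    (3 * T + T) * a            ≡⟨ cong (_* a) (collect T) ⟩
    4 * T * a                  ≤⟨ ℕ.*-monoˡ-≤ a (ℕ.*-monoˡ-≤ T 4≤q) ⟩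
    q * T * a                  ∎
    where
    P = q ^ j
    T = q ^ (d + m)
    a = ∣ H d m j ∣
    c = ∣ H d m (suc j) ∣
    expand : ∀ P q c a → 2 * (P * (q * c + a)) ≡ 2 * (q * P) * c + 2 * (P * a)
    expand = ℕ-Solver.solve-∀
    regroup : ∀ T a P → 3 * T * a + 4 * (P * a) ≡ (3 * T + 4 * P) * a
    regroup = ℕ-Solver.solve-∀
    collect : ∀ T → 3 * T + T ≡ 4 * T
    collect = ℕ-Solver.solve-∀
  -- For `j = d` the next value `H d m (suc d)` is 0, so only `2 * (P * a)` remains.
  ... | inj₂ refl = begin-strict
    2 * (P * (q * ∣ H d m (suc d) ∣ + a))
      ≡⟨ cong (λ x → 2 * (P * (q * ∣ x ∣ + a))) (H≡0 {d} {m} (ℕ.n<1+n d) m≤d) ⟩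
    2 * (P * (q * 0 + a))      ≡⟨ drop P q a ⟩
    2 * (P * a)                <⟨ ℕ.*-monoˡ-< (P * a) {{>-nonZero (0<* (0<q^n d) 0<a)}} {2} {4} (s≤s (s≤s (s≤s z≤n))) ⟩
    4 * (P * a)                ≡⟨ ℕ.*-assoc 4 P a ⟨
    4 * P * a                  ≤⟨ ℕ.*-monoˡ-≤ a (4*q^m≤q^n (s≤s (ℕ.m≤m+n d m))) ⟩
    q ^ suc (d + m) * a        ∎
    where
    P = q ^ d
    a = ∣ H d m d ∣
    drop : ∀ P q a → 2 * (P * (q * 0 + a)) ≡ 2 * (P * a)
    drop = ℕ-Solver.solve-∀

  module _ {d m} (m≤d : m ≤ d) j (dom : Dominated d m j) where
    private
      E : ℤ
      E = b ℤ.^ j ℤ.* (b ℤ.* H d m (suc j) ℤ.- H d m j)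
      M : ℤ
      M = b ℤ.^ suc (d + m) ℤ.* H d m j

    correction-small : 2 * ∣ E ∣ < ∣ M ∣
    correction-small = begin-strict
        2 * ∣ E ∣
          ≡⟨ cong (2 *_) (∣b^n*x∣ j (b ℤ.* H d m (suc j) ℤ.- H d m j)) ⟩
        2 * (q ^ j * ∣ b ℤ.* H d m (suc j) ℤ.- H d m j ∣)
          ≤⟨ ℕ.*-monoʳ-≤ 2 (ℕ.*-monoʳ-≤ (q ^ j) (ℤ.∣i-j∣≤∣i∣+∣j∣ (b ℤ.* H d m (suc j)) (H d m j))) ⟩
        2 * (q ^ j * (∣ b ℤ.* H d m (suc j) ∣ + ∣ H d m j ∣))
          ≡⟨ cong (λ x → 2 * (q ^ j * (x + ∣ H d m j ∣)))
               (trans (ℤ.abs-* b (H d m (suc j))) (cong (_* ∣ H d m (suc j) ∣) (ℤ.∣-i∣≡∣i∣ (+ q)))) ⟩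
        2 * (q ^ j * (q * ∣ H d m (suc j) ∣ + ∣ H d m j ∣))
          <⟨ dom ⟩
        q ^ suc (d + m) * ∣ H d m j ∣
          ≡⟨ ∣b^n*x∣ (suc (d + m)) (H d m j) ⟨
        ∣ M ∣ ∎

    private
      H′≡E-M : H (suc d) (suc m) (suc j) ≡ E ℤ.- M
      H′≡E-M = H-suc-d-suc-m m≤d j

    -- Write `M` as `E - (E - M)`: then `2 * ∣ M ∣` is at most `2 * ∣ E ∣ + 2 * ∣ E - M ∣`, and
    -- `2 * ∣ E ∣` is less than `∣ M ∣`.
    dominant-lower : q ^ suc (d + m) * ∣ H d m j ∣ < 2 * ∣ H (suc d) (suc m) (suc j) ∣
    dominant-lower = ℕ.+-cancelʳ-< ∣ M ∣ _ _ (begin-strict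
      q ^ suc (d + m) * ∣ H d m j ∣ + ∣ M ∣ ≡⟨ cong (_+ ∣ M ∣) (∣b^n*x∣ (suc (d + m)) (H d m j)) ⟨
      ∣ M ∣ + ∣ M ∣                         ≡⟨ double ∣ M ∣ ⟩
      2 * ∣ M ∣                             ≡⟨ cong (λ x → 2 * ∣ x ∣) (M≡E-H′ E M) ⟩
      2 * ∣ E ℤ.- (E ℤ.- M) ∣               ≤⟨ ℕ.*-monoʳ-≤ 2 (ℤ.∣i-j∣≤∣i∣+∣j∣ E (E ℤ.- M)) ⟩
      2 * (∣ E ∣ + ∣ E ℤ.- M ∣)             ≡⟨ ℕ.*-distribˡ-+ 2 ∣ E ∣ ∣ E ℤ.- M ∣ ⟩
      2 * ∣ E ∣ + 2 * ∣ E ℤ.- M ∣           <⟨ ℕ.+-monoˡ-< (2 * ∣ E ℤ.- M ∣) correction-small ⟩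
      ∣ M ∣ + 2 * ∣ E ℤ.- M ∣               ≡⟨ ℕ.+-comm ∣ M ∣ _ ⟩
      2 * ∣ E ℤ.- M ∣ + ∣ M ∣               ≡⟨ cong (λ x → 2 * ∣ x ∣ + ∣ M ∣) H′≡E-M ⟨
      2 * ∣ H (suc d) (suc m) (suc j) ∣ + ∣ M ∣ ∎)
      where
      double : ∀ x → x + x ≡ 2 * x
      double = ℕ-Solver.solve-∀
      M≡E-H′ : ∀ E M → M ≡ E ℤ.- (E ℤ.- M)
      M≡E-H′ = solve-∀

    dominant-upper : 2 * ∣ H (suc d) (suc m) (suc j) ∣ ≤ 3 * (q ^ suc (d + m) * ∣ H d m j ∣)
    dominant-upper = begin
      2 * ∣ H (suc d) (suc m) (suc j) ∣    ≡⟨ cong (λ x → 2 * ∣ x ∣) H′≡E-M ⟩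
      2 * ∣ E ℤ.- M ∣                      ≤⟨ ℕ.*-monoʳ-≤ 2 (ℤ.∣i-j∣≤∣i∣+∣j∣ E M) ⟩
      2 * (∣ E ∣ + ∣ M ∣)                  ≡⟨ ℕ.*-distribˡ-+ 2 ∣ E ∣ ∣ M ∣ ⟩
      2 * ∣ E ∣ + 2 * ∣ M ∣                ≤⟨ ℕ.+-monoˡ-≤ (2 * ∣ M ∣) (ℕ.<⇒≤ correction-small) ⟩
      3 * ∣ M ∣                            ≡⟨ cong (3 *_) (∣b^n*x∣ (suc (d + m)) (H d m j)) ⟩
      3 * (q ^ suc (d + m) * ∣ H d m j ∣)  ∎

    -- The left side is `∣ E ∣`, less than half of `∣ M ∣`; the right side is more than half of it.
    decrease : ∣ H (suc d) m (suc j) ∣ < ∣ H (suc d) (suc m) (suc j) ∣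
    decrease = ℕ.*-cancelˡ-< 2 _ _ (begin-strict
      2 * ∣ H (suc d) m (suc j) ∣         ≡⟨ cong (λ x → 2 * ∣ x ∣) (trans (H-suc-d m≤d j) (factor b (b ℤ.^ j) (H d m (suc j)) (H d m j))) ⟩
      2 * ∣ E ∣                           <⟨ correction-small ⟩
      ∣ M ∣                               ≡⟨ ∣b^n*x∣ (suc (d + m)) (H d m j) ⟩
      q ^ suc (d + m) * ∣ H d m j ∣       <⟨ dominant-lower ⟩
      2 * ∣ H (suc d) (suc m) (suc j) ∣   ∎)
      where
      factor : ∀ b p x y → b ℤ.* p ℤ.* x ℤ.- p ℤ.* y ≡ p ℤ.* (b ℤ.* x ℤ.- y)
      factor = solve-∀

  -- `H-first` gives `suc q * c ≤ 1 + T`. After doubling, the surplus 2 is absorbed by a third `T`,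
  -- which is at least 2 because `d > 0`.
  upper-first : ∀ {d m} → m ≤ d → 0 < d → UpperBound d m 0
  upper-first {d} {m} m≤d 0<d = begin
    2 * (q * 1) * c         ≡⟨ assoc q c ⟩
    2 * (q * c)             ≤⟨ ℕ.*-monoʳ-≤ 2 (ℕ.*-monoˡ-≤ c (ℕ.n≤1+n q)) ⟩
    2 * (suc q * c)         ≤⟨ ℕ.*-monoʳ-≤ 2 [q+1]c≤1+T ⟩
    2 * (1 + T)             ≡⟨ ℕ.*-distribˡ-+ 2 1 T ⟩
    2 + 2 * T               ≤⟨ ℕ.+-monoˡ-≤ (2 * T) 2≤T ⟩
    3 * T                   ≡⟨ ℕ.*-identityʳ (3 * T) ⟨
    3 * T * 1               ∎
    where
    c = ∣ H d m 1 ∣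
    T = q ^ (d + m)
    assoc : ∀ q c → 2 * (q * 1) * c ≡ 2 * (q * c)
    assoc = ℕ-Solver.solve-∀
    [q+1]c≤1+T : suc q * c ≤ 1 + T
    [q+1]c≤1+T = begin
      suc q * c                        ≡⟨ cong (_* c) ∣b-1∣≡q+1 ⟨
      ∣ b ℤ.- 1ℤ ∣ * c                 ≡⟨ ℤ.abs-* (b ℤ.- 1ℤ) (H d m 1) ⟨
      ∣ (b ℤ.- 1ℤ) ℤ.* H d m 1 ∣       ≡⟨ cong ∣_∣ (H-first m≤d) ⟩
      ∣ 1ℤ ℤ.- b ℤ.^ (d + m) ∣         ≤⟨ ℤ.∣i-j∣≤∣i∣+∣j∣ 1ℤ (b ℤ.^ (d + m)) ⟩
      1 + ∣ b ℤ.^ (d + m) ∣            ≡⟨ cong suc (∣b^n∣≡q^n (d + m)) ⟩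
      1 + T                            ∎
    2≤T : 2 ≤ T
    2≤T = ℕ.≤-trans (s≤s (s≤s z≤n)) (4*q^m≤q^n {0} (ℕ.<-≤-trans 0<d (ℕ.m≤m+n d m)))

  -- If the value at `suc j` were 0, `H-ratio` would make `b ^ j` and `b ^ d` agree on a nonzero
  -- multiple, although `j < d`.
  nonzero-base : ∀ d j → j ≤ d → 0 < ∣ H d 0 j ∣
  nonzero-base d zero    _   = s≤s z≤n
  nonzero-base d (suc j) j<d = ℕ.n≢0⇒n>0 λ c≡0 →
    ℕ.<⇒≢ (ℕ.*-monoˡ-< a {{>-nonZero (nonzero-base d j (ℕ.<⇒≤ j<d))}}
             (ℕ.^-monoʳ-< q (ℕ.≤-trans (s≤s (s≤s z≤n)) 4≤q) j<d)) (begin-equality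
      q ^ j * a                                         ≡⟨ ∣b^n*x∣ j (H d 0 j) ⟨
      ∣ b ℤ.^ j ℤ.* H d 0 j ∣                           ≡⟨ cong ∣_∣ (same (ℤ.∣i∣≡0⇒i≡0 c≡0)) ⟩
      ∣ b ℤ.^ d ℤ.* H d 0 j ∣                           ≡⟨ ∣b^n*x∣ d (H d 0 j) ⟩
      q ^ d * a                                         ∎)
    where
    a = ∣ H d 0 j ∣
    same : H d 0 (suc j) ≡ 0ℤ → b ℤ.^ j ℤ.* H d 0 j ≡ b ℤ.^ d ℤ.* H d 0 j
    same Y≡0 = ℤ.i-j≡0⇒i≡j _ _ (trans (factor (b ℤ.^ j) (b ℤ.^ d) (H d 0 j)) (trans
      (sym (H-ratio d j))
      (trans (cong ((b ℤ.^ suc j ℤ.- 1ℤ) ℤ.*_) Y≡0) (ℤ.*-zeroʳ (b ℤ.^ suc j ℤ.- 1ℤ)))))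
      where
      factor : ∀ p r x → p ℤ.* x ℤ.- r ℤ.* x ≡ (p ℤ.- r) ℤ.* x
      factor = solve-∀

  upper-base : ∀ d j → j < d → UpperBound d 0 j
  upper-base d zero    0<d   = upper-first z≤n 0<d
  -- By `H-ratio`, `(P - 1) * c ≤ (R + T) * a`. As `P ≥ 16`, replacing `P - 1` by `P` costs a factor
  -- 16/15, and `4 * R ≤ T`. After multiplication by 15 the claim becomes 40 ≤ 45 as a comparison of
  -- multiples of `T * a`.
  upper-base d (suc j) 1+j<d = ℕ.*-cancelˡ-≤ 15 (begin
    15 * (2 * P * c)          ≡⟨ swap P c ⟩
    2 * (15 * (P * c))        ≤⟨ ℕ.*-monoʳ-≤ 2 15Pc≤16S ⟩
    2 * (16 * ((R + T) * a))  ≡⟨ regroup R T a ⟩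
    (8 * (4 * R) + 32 * T) * a ≤⟨ ℕ.*-monoˡ-≤ a (ℕ.+-monoˡ-≤ (32 * T) (ℕ.*-monoʳ-≤ 8 (4*q^m≤q^n 1+j<d))) ⟩
    (8 * T + 32 * T) * a      ≤⟨ ℕ.*-monoˡ-≤ a (ℕ.m≤m+n (8 * T + 32 * T) (5 * T)) ⟩
    (8 * T + 32 * T + 5 * T) * a ≡⟨ collect T a ⟩
    15 * (3 * T * a)          ≡⟨ cong (λ e → 15 * (3 * q ^ e * a)) (ℕ.+-identityʳ d) ⟨
    15 * (3 * q ^ (d + 0) * a) ∎)
    where
    a = ∣ H d 0 (suc j) ∣
    c = ∣ H d 0 (2 + j) ∣
    P = q ^ (2 + j)
    R = q ^ suc j
    T = q ^ d
    swap : ∀ P c → 15 * (2 * P * c) ≡ 2 * (15 * (P * c))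
    swap = ℕ-Solver.solve-∀
    regroup : ∀ R T a → 2 * (16 * ((R + T) * a)) ≡ (8 * (4 * R) + 32 * T) * a
    regroup = ℕ-Solver.solve-∀
    collect : ∀ T a → (8 * T + 32 * T + 5 * T) * a ≡ 15 * (3 * T * a)
    collect = ℕ-Solver.solve-∀
    Pc≤c+S : P * c ≤ c + (R + T) * a
    Pc≤c+S = begin
      P * c                                    ≡⟨ ∣b^n*x∣ (2 + j) (H d 0 (2 + j)) ⟨
      ∣ b ℤ.^ (2 + j) ℤ.* H d 0 (2 + j) ∣      ≡⟨ cong ∣_∣ (expand (b ℤ.^ (2 + j)) (H d 0 (2 + j))) ⟩
      ∣ H d 0 (2 + j) ℤ.+ (b ℤ.^ (2 + j) ℤ.- 1ℤ) ℤ.* H d 0 (2 + j) ∣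
        ≡⟨ cong (λ x → ∣ H d 0 (2 + j) ℤ.+ x ∣) (H-ratio d (suc j)) ⟩
      ∣ H d 0 (2 + j) ℤ.+ (b ℤ.^ suc j ℤ.- b ℤ.^ d) ℤ.* H d 0 (suc j) ∣
        ≤⟨ ℤ.∣i+j∣≤∣i∣+∣j∣ (H d 0 (2 + j)) _ ⟩
      c + ∣ (b ℤ.^ suc j ℤ.- b ℤ.^ d) ℤ.* H d 0 (suc j) ∣
        ≡⟨ cong (λ x → c + x) (ℤ.abs-* (b ℤ.^ suc j ℤ.- b ℤ.^ d) (H d 0 (suc j))) ⟩
      c + ∣ b ℤ.^ suc j ℤ.- b ℤ.^ d ∣ * a
        ≤⟨ ℕ.+-monoʳ-≤ c (ℕ.*-monoˡ-≤ a (ℤ.∣i-j∣≤∣i∣+∣j∣ (b ℤ.^ suc j) (b ℤ.^ d))) ⟩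
      c + (∣ b ℤ.^ suc j ∣ + ∣ b ℤ.^ d ∣) * a
        ≡⟨ cong₂ (λ x y → c + (x + y) * a) (∣b^n∣≡q^n (suc j)) (∣b^n∣≡q^n d) ⟩
      c + (R + T) * a ∎
      where
      expand : ∀ p x → p ℤ.* x ≡ x ℤ.+ (p ℤ.- 1ℤ) ℤ.* x
      expand = solve-∀
    15Pc≤16S : 15 * (P * c) ≤ 16 * ((R + T) * a)
    15Pc≤16S = ℕ.+-cancelˡ-≤ (P * c) _ _ (begin
      16 * (P * c)                     ≤⟨ ℕ.*-monoʳ-≤ 16 Pc≤c+S ⟩
      16 * (c + (R + T) * a)           ≡⟨ ℕ.*-distribˡ-+ 16 c _ ⟩
      16 * c + 16 * ((R + T) * a)      ≤⟨ ℕ.+-monoˡ-≤ (16 * ((R + T) * a)) (ℕ.*-monoˡ-≤ c 16≤P) ⟩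
      P * c + 16 * ((R + T) * a)       ∎)
      where
      16≤P : 16 ≤ P
      16≤P = ℕ.≤-trans (ℕ.*-monoʳ-≤ 4 (4*q^m≤q^n {0} {suc j} (s≤s z≤n))) (4*q^m≤q^n (ℕ.n<1+n (suc j)))

  -- A simultaneous induction: `nonzero` and `upper` at `suc d`, `suc m`, `suc j` rest on
  -- `dominates` at `d`, `m`, which follows from those two at `d`, `m`. The base cases are `j = 0`
  -- and `m = 0`.
  nonzero : ∀ {d m} → m ≤ d → ∀ j → j ≤ d → 0 < ∣ H d m j ∣
  upper   : ∀ {d m} → m ≤ d → ∀ j → j < d → UpperBound d m j
  dominates : ∀ {d m} → m ≤ d → ∀ j → j ≤ d → Dominated d m j

  dominates m≤d j j≤d = dominated m≤d j≤d (nonzero m≤d j j≤d) (upper m≤d j)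

  nonzero m≤d zero _ = s≤s z≤n
  nonzero {d} {zero} _ j@(suc _) j≤d = nonzero-base d j j≤d
  nonzero {suc d} {suc m} (s≤s m≤d) (suc j) (s≤s j≤d) = ℕ.*-cancelˡ-< 2 _ _ (ℕ.≤-<-trans z≤n
    (dominant-lower m≤d j (dominates m≤d j j≤d)))

  upper m≤d zero 0<d = upper-first m≤d 0<d
  upper {d} {zero} _ j@(suc _) j<d = upper-base d j j<d
  -- The numerator `h₂` is at most 3/2 of `T * a₁` and the denominator `h₁` more than 1/2 of
  -- `T * a₀`, so the ratio grows by at most 3. The permitted ratio grows by `q`.
  upper {suc d} {suc m} (s≤s m≤d) (suc j) (s≤s 1+j≤d) = ℕ.*-cancelˡ-≤ 2 (begin
    2 * (2 * (q * P) * h₂)         ≡⟨ swap q P h₂ ⟩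
    2 * (q * P) * (2 * h₂)         ≤⟨ ℕ.*-monoʳ-≤ (2 * (q * P)) (dominant-upper m≤d (suc j) (dominates m≤d (suc j) 1+j≤d)) ⟩
    2 * (q * P) * (3 * (T * a₁))   ≡⟨ rotate q P T a₁ ⟩
    3 * q * T * (2 * P * a₁)       ≤⟨ ℕ.*-monoʳ-≤ (3 * q * T) (upper m≤d j 1+j≤d) ⟩
    3 * q * T * (3 * S * a₀)       ≡⟨ square q S T a₀ ⟩
    9 * T * (T * a₀)               ≤⟨ ℕ.*-monoʳ-≤ (9 * T) (ℕ.<⇒≤ (dominant-lower m≤d j (dominates m≤d j (ℕ.<⇒≤ 1+j≤d)))) ⟩
    9 * T * (2 * h₁)               ≡⟨ regroup T h₁ ⟩
    3 * (6 * (T * h₁))             ≤⟨ ℕ.*-monoˡ-≤ (6 * (T * h₁)) (ℕ.<⇒≤ 4≤q) ⟩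
    q * (6 * (T * h₁))             ≡⟨ collect q T h₁ ⟩
    2 * (3 * (q * T) * h₁)         ≡⟨ cong (λ e → 2 * (3 * q ^ suc e * h₁)) (ℕ.+-suc d m) ⟨
    2 * (3 * q ^ (suc d + suc m) * h₁) ∎)
    where
    P  = q ^ suc j
    S  = q ^ (d + m)
    T  = q * S
    a₀ = ∣ H d m j ∣
    a₁ = ∣ H d m (suc j) ∣
    h₁ = ∣ H (suc d) (suc m) (suc j) ∣
    h₂ = ∣ H (suc d) (suc m) (2 + j) ∣
    swap : ∀ q P h → 2 * (2 * (q * P) * h) ≡ 2 * (q * P) * (2 * h)
    swap = ℕ-Solver.solve-∀
    rotate : ∀ q P T a → 2 * (q * P) * (3 * (T * a)) ≡ 3 * q * T * (2 * P * a)
    rotate = ℕ-Solver.solve-∀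
    square : ∀ q S T a → 3 * q * T * (3 * S * a) ≡ 9 * T * (q * S * a)
    square = ℕ-Solver.solve-∀
    regroup : ∀ T h → 9 * T * (2 * h) ≡ 3 * (6 * (T * h))
    regroup = ℕ-Solver.solve-∀
    collect : ∀ q T h → q * (6 * (T * h)) ≡ 2 * (3 * (q * T) * h)
    collect = ℕ-Solver.solve-∀

  ∣H∣-increasing : ∀ {d m} → m < d → ∀ j → 1 ≤ j → j ≤ d → ∣ H d m j ∣ < ∣ H d (suc m) j ∣
  ∣H∣-increasing {suc d} (s≤s m≤d) (suc j) _ (s≤s j≤d) = decrease m≤d j (dominates m≤d j j≤d)

-- Signs of the eigenvalues.

module EigenvalueSigns (q : ℕ) (4≤q : 4 ≤ q) where
  open import Data.Integer.Base using (ℤ; +_; -_; 1ℤ; ∣_∣; sign)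
  open import Data.Nat.Base hiding (∣_-_∣)
  open Signs
  open Estimates q 4≤q
  open Recurrences.Eigenvalues b
  open ≡-Reasoning

  sign-b : sign b ≡ Sign.-
  sign-b = sign-neg (+ q) 0<q

  0<∣b∣ : 0 < ∣ b ∣
  0<∣b∣ = subst (0 <_) (sym (ℤ.∣-i∣≡∣i∣ (+ q))) 0<q

  0<∣b^n∣ : ∀ n → 0 < ∣ b ℤ.^ n ∣
  0<∣b^n∣ n = subst (0 <_) (sym (∣b^n∣≡q^n n)) (0<q^n n)

  sign-b^suc : ∀ n → sign (b ℤ.^ suc n) ≡ Sign.opposite (sign (b ℤ.^ n))
  sign-b^suc n = trans (sign-homo-* b (b ℤ.^ n) 0<∣b∣ (0<∣b^n∣ n)) (cong (Sign._* sign (b ℤ.^ n)) sign-b)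

  sign-b^even : ∀ n → sign (b ℤ.^ (n + n)) ≡ Sign.+
  sign-b^even n = begin
    sign (b ℤ.^ (n + n))                     ≡⟨ cong sign (ℤ.^-distribˡ-+-* b n n) ⟩
    sign (b ℤ.^ n ℤ.* b ℤ.^ n)               ≡⟨ sign-homo-* (b ℤ.^ n) (b ℤ.^ n) (0<∣b^n∣ n) (0<∣b^n∣ n) ⟩
    sign (b ℤ.^ n) Sign.* sign (b ℤ.^ n)     ≡⟨ Sign.s*s≡+ (sign (b ℤ.^ n)) ⟩
    Sign.+                                   ∎

  ∣b^n∣-mono-< : ∀ {m n} → m < n → ∣ b ℤ.^ m ∣ < ∣ b ℤ.^ n ∣
  ∣b^n∣-mono-< {m} {n} m<n = subst₂ _<_ (sym (∣b^n∣≡q^n m)) (sym (∣b^n∣≡q^n n))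
    (ℕ.^-monoʳ-< q (ℕ.≤-trans (s≤s (s≤s z≤n)) 4≤q) m<n)

  -- By `correction-small`, `E` cannot affect the sign of `E - M`.
  sign-step : ∀ {d m} → m ≤ d → ∀ j → j ≤ d → sign (H (suc d) (suc m) (suc j)) ≡
    Sign.opposite (sign (b ℤ.^ suc (d + m)) Sign.* sign (H d m j))
  sign-step {d} {m} m≤d j j≤d = begin
    sign (H (suc d) (suc m) (suc j))   ≡⟨ cong sign (H-suc-d-suc-m m≤d j) ⟩
    sign (E ℤ.- M)                     ≡⟨ sign-minus E M (ℕ.≤-<-trans (ℕ.m≤m+n ∣ E ∣ _) (correction-small m≤d j (dominates m≤d j j≤d))) ⟩
    Sign.opposite (sign M)             ≡⟨ cong Sign.opposite (sign-homo-* (b ℤ.^ suc (d + m)) (H d m j)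
                                            (0<∣b^n∣ (suc (d + m))) (nonzero m≤d j j≤d)) ⟩
    Sign.opposite (sign (b ℤ.^ suc (d + m)) Sign.* sign (H d m j)) ∎
    where
    E = b ℤ.^ j ℤ.* (b ℤ.* H d m (suc j) ℤ.- H d m j)
    M = b ℤ.^ suc (d + m) ℤ.* H d m j

  -- Between the two steps the exponent `suc (d + m)` grows by 2, so both contribute the same sign
  -- `e`. The two copies of `e` cancel, and so do the two reversals.
  sign-step² : ∀ {d m} → m ≤ d → ∀ j → j ≤ d → sign (H (2 + d) (2 + m) (2 + j)) ≡ sign (H d m j)
  sign-step² {d} {m} m≤d j j≤d = begin
    sign (H (2 + d) (2 + m) (2 + j))
      ≡⟨ sign-step (s≤s m≤d) (suc j) (s≤s j≤d) ⟩
    Sign.opposite (sign (b ℤ.^ suc (suc d + suc m)) Sign.* sign (H (suc d) (suc m) (suc j)))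
      ≡⟨ cong₂ (λ s t → Sign.opposite (s Sign.* t)) power (sign-step m≤d j j≤d) ⟩
    Sign.opposite (e Sign.* Sign.opposite (e Sign.* sign (H d m j)))
      ≡⟨ cancel e (sign (H d m j)) ⟩
    sign (H d m j) ∎
    where
    e = sign (b ℤ.^ suc (d + m))
    power : sign (b ℤ.^ suc (suc d + suc m)) ≡ e
    power = begin
      sign (b ℤ.^ suc (suc d + suc m))          ≡⟨ cong (λ n → sign (b ℤ.^ (2 + n))) (ℕ.+-suc d m) ⟩
      sign (b ℤ.^ (3 + (d + m)))                ≡⟨ sign-b^suc (2 + (d + m)) ⟩
      Sign.opposite (sign (b ℤ.^ (2 + (d + m)))) ≡⟨ cong Sign.opposite (sign-b^suc (suc (d + m))) ⟩
      Sign.opposite (Sign.opposite e)           ≡⟨ Sign.opposite-involutive e ⟩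
      e                                         ∎
    cancel : ∀ s t → Sign.opposite (s Sign.* Sign.opposite (s Sign.* t)) ≡ t
    cancel Sign.+ Sign.+ = refl
    cancel Sign.+ Sign.- = refl
    cancel Sign.- Sign.+ = refl
    cancel Sign.- Sign.- = refl

  sign-reduce : ∀ k {d m j} → k * 2 ≤ m → m ≤ d → k * 2 + j ≤ d →
                sign (H d m (k * 2 + j)) ≡ sign (H (d ∸ k * 2) (m ∸ k * 2) j)
  sign-reduce zero    _ _ _ = refl
  sign-reduce (suc k) {j = j} (s≤s (s≤s 2k≤m)) (s≤s (s≤s m≤d)) (s≤s (s≤s 2k+j≤d)) =
    trans (sign-step² m≤d (k * 2 + j) 2k+j≤d) (sign-reduce k 2k≤m m≤d 2k+j≤d)

  -- In `H-first` the factor `b - 1` is negative, and `1 - b ^ (d + m)` has the sign opposite to its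
  -- power.
  sign-first : ∀ {d m} → m ≤ d → 0 < d → sign (H d m 1) ≡ sign (b ℤ.^ (d + m))
  sign-first {d} {m} m≤d 0<d = begin
    sign (H d m 1)                                ≡⟨ Sign.opposite-involutive _ ⟨
    Sign.opposite (Sign.- Sign.* sign (H d m 1))  ≡⟨ cong (λ s → Sign.opposite (s Sign.* sign (H d m 1))) sign[b-1] ⟨
    Sign.opposite (sign (b ℤ.- 1ℤ) Sign.* sign (H d m 1))
      ≡⟨ cong Sign.opposite (sign-homo-* (b ℤ.- 1ℤ) (H d m 1) (subst (0 <_) (sym ∣b-1∣≡q+1) (s≤s z≤n)) (nonzero m≤d 1 0<d)) ⟨
    Sign.opposite (sign ((b ℤ.- 1ℤ) ℤ.* H d m 1)) ≡⟨ cong (λ x → Sign.opposite (sign x)) (H-first m≤d) ⟩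
    Sign.opposite (sign (1ℤ ℤ.- b ℤ.^ (d + m)))
      ≡⟨ cong Sign.opposite (sign-minus 1ℤ (b ℤ.^ (d + m)) (∣b^n∣-mono-< {0} (ℕ.<-≤-trans 0<d (ℕ.m≤m+n d m)))) ⟩
    Sign.opposite (Sign.opposite (sign (b ℤ.^ (d + m)))) ≡⟨ Sign.opposite-involutive _ ⟩
    sign (b ℤ.^ (d + m))                          ∎
    where
    sign[b-1] : sign (b ℤ.- 1ℤ) ≡ Sign.-
    sign[b-1] = trans
      (sign-absorb b (- 1ℤ) (subst (1 <_) (sym (ℤ.∣-i∣≡∣i∣ (+ q))) (ℕ.≤-trans (s≤s (s≤s z≤n)) 4≤q)))
      sign-b

  -- One `sign-step` leads to `H d 0 1`, with the sign of `b ^ d`; the accompanying factor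
  -- `b ^ suc d` has the opposite sign.
  sign-second₁ : ∀ {d} → 2 ≤ d → sign (H d 1 2) ≡ Sign.+
  sign-second₁ {suc d} (s≤s 1≤d) = begin
    sign (H (suc d) 1 2)
      ≡⟨ sign-step {d} {0} z≤n 1 1≤d ⟩
    Sign.opposite (sign (b ℤ.^ suc (d + 0)) Sign.* sign (H d 0 1))
      ≡⟨ cong₂ (λ s t → Sign.opposite (s Sign.* t)) (sign-b^suc (d + 0)) (sign-first {d} {0} z≤n 1≤d) ⟩
    Sign.opposite (Sign.opposite e Sign.* e)
      ≡⟨ cancel e ⟩
    Sign.+ ∎
    where
    e = sign (b ℤ.^ (d + 0))
    cancel : ∀ s → Sign.opposite (Sign.opposite s Sign.* s) ≡ Sign.+
    cancel Sign.+ = refl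
    cancel Sign.- = refl

  -- In `H-ratio` for `j = 1`, `b ^ 2 - 1` is positive, while `b - b ^ d` and `H d 0 1` have
  -- opposite signs.
  sign-second₀ : ∀ {d} → 2 ≤ d → sign (H d 0 2) ≡ Sign.-
  sign-second₀ {d} 2≤d = begin
    sign (H d 0 2)
      ≡⟨ cong (Sign._* sign (H d 0 2)) sign[b²-1] ⟨
    sign (b ℤ.^ 2 ℤ.- 1ℤ) Sign.* sign (H d 0 2)
      ≡⟨ sign-homo-* (b ℤ.^ 2 ℤ.- 1ℤ) (H d 0 2) 0<∣b²-1∣ (nonzero {d} {0} z≤n 2 2≤d) ⟨
    sign ((b ℤ.^ 2 ℤ.- 1ℤ) ℤ.* H d 0 2)
      ≡⟨ cong sign (H-ratio d 1) ⟩
    sign ((b ℤ.^ 1 ℤ.- b ℤ.^ d) ℤ.* H d 0 1)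
      ≡⟨ sign-homo-* (b ℤ.^ 1 ℤ.- b ℤ.^ d) (H d 0 1) 0<∣b-b^d∣ (nonzero {d} {0} z≤n 1 1≤d) ⟩
    sign (b ℤ.^ 1 ℤ.- b ℤ.^ d) Sign.* sign (H d 0 1)
      ≡⟨ cong₂ Sign._*_ (sign-minus (b ℤ.^ 1) (b ℤ.^ d) (∣b^n∣-mono-< 2≤d))
           (trans (sign-first {d} {0} z≤n 1≤d) (cong (λ n → sign (b ℤ.^ n)) (ℕ.+-identityʳ d))) ⟩
    Sign.opposite (sign (b ℤ.^ d)) Sign.* sign (b ℤ.^ d)
      ≡⟨ cancel (sign (b ℤ.^ d)) ⟩
    Sign.- ∎
    where
    1≤d : 1 ≤ d
    1≤d = ℕ.<⇒≤ 2≤d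
    cancel : ∀ s → Sign.opposite s Sign.* s ≡ Sign.-
    cancel Sign.+ = refl
    cancel Sign.- = refl
    sign[b²-1] : sign (b ℤ.^ 2 ℤ.- 1ℤ) ≡ Sign.+
    sign[b²-1] = trans (sign-absorb (b ℤ.^ 2) (- 1ℤ) (∣b^n∣-mono-< {0} {2} (s≤s z≤n))) (sign-b^even 1)
    difference≢0 : ∀ x y → ∣ y ∣ < ∣ x ∣ → 0 < ∣ x ℤ.- y ∣
    difference≢0 x y y<x = ℕ.n≢0⇒n>0 λ ∣x-y∣≡0 →
      ℕ.<⇒≢ y<x (cong ∣_∣ (sym (ℤ.i-j≡0⇒i≡j x y (ℤ.∣i∣≡0⇒i≡0 ∣x-y∣≡0))))
    0<∣b²-1∣ : 0 < ∣ b ℤ.^ 2 ℤ.- 1ℤ ∣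
    0<∣b²-1∣ = difference≢0 (b ℤ.^ 2) 1ℤ (∣b^n∣-mono-< {0} {2} (s≤s z≤n))
    0<∣b-b^d∣ : 0 < ∣ b ℤ.^ 1 ℤ.- b ℤ.^ d ∣
    0<∣b-b^d∣ = subst (0 <_) (ℤ.∣i-j∣≡∣j-i∣ (b ℤ.^ d) (b ℤ.^ 1))
      (difference≢0 (b ℤ.^ d) (b ℤ.^ 1) (∣b^n∣-mono-< 2≤d))

  sign-odd-0 : ∀ k {d} → k * 2 + 1 ≤ d → sign (H d d (k * 2 + 1)) ≡ Sign.+
  sign-odd-0 k {d} 2k<d = trans (sign-reduce k (ℕ.m+n≤o⇒m≤o (k * 2) 2k<d) ℕ.≤-refl 2k<d)
    (trans (sign-first ℕ.≤-refl (ℕ.m+n≤o⇒m≤o∸n 1 (subst (_≤ d) (ℕ.+-comm (k * 2) 1) 2k<d))) (sign-b^even (d ∸ k * 2)))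

  sign-odd-1 : ∀ k {m} → k * 2 ≤ m → sign (H (suc m) m (k * 2 + 1)) ≡ Sign.-
  sign-odd-1 k {m} 2k≤m = begin
    sign (H (suc m) m (k * 2 + 1))
      ≡⟨ sign-reduce k 2k≤m (ℕ.n≤1+n m) (subst (_≤ suc m) (ℕ.+-comm 1 (k * 2)) (s≤s 2k≤m)) ⟩
    sign (H (suc m ∸ k * 2) (m ∸ k * 2) 1)
      ≡⟨ cong (λ d → sign (H d (m ∸ k * 2) 1)) (ℕ.+-∸-assoc 1 2k≤m) ⟩
    sign (H (suc (m ∸ k * 2)) (m ∸ k * 2) 1)
      ≡⟨ sign-first (ℕ.n≤1+n (m ∸ k * 2)) (s≤s z≤n) ⟩
    sign (b ℤ.^ suc (m ∸ k * 2 + (m ∸ k * 2)))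
      ≡⟨ trans (sign-b^suc (m ∸ k * 2 + (m ∸ k * 2))) (cong Sign.opposite (sign-b^even (m ∸ k * 2))) ⟩
    Sign.- ∎

  -- With `m ≥ j` the reduction reaches `j = 0`, where the value is 1.
  sign-even-large : ∀ k {d m} → k * 2 ≤ m → m ≤ d → sign (H d m (k * 2)) ≡ Sign.+
  sign-even-large k {d} {m} 2k≤m m≤d = trans
    (cong (λ j → sign (H d m j)) (sym (ℕ.+-identityʳ (k * 2))))
    (sign-reduce k 2k≤m m≤d (subst (_≤ d) (sym (ℕ.+-identityʳ (k * 2))) (ℕ.≤-trans 2k≤m m≤d)))

  -- For `m = j - 2` and `m = j - 1`, that is `t = 0` and `t = 1`, only `k` double steps fit into
  -- `m`, so the reduction stops at `j = 2`.
  sign-even-reduce : ∀ k {d} t → suc k * 2 ≤ d → t ≤ 1 →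
                     sign (H d (t + k * 2) (suc k * 2)) ≡ sign (H (d ∸ k * 2) t 2)
  sign-even-reduce k {d} t 2k+2≤d t≤1 = begin
    sign (H d (t + k * 2) (2 + k * 2))
      ≡⟨ cong (λ j → sign (H d (t + k * 2) j)) (ℕ.+-comm 2 (k * 2)) ⟩
    sign (H d (t + k * 2) (k * 2 + 2))
      ≡⟨ sign-reduce k (ℕ.m≤n+m (k * 2) t)
           (ℕ.≤-trans (ℕ.+-monoˡ-≤ (k * 2) (ℕ.≤-trans t≤1 (s≤s z≤n))) 2k+2≤d)
           (subst (_≤ d) (ℕ.+-comm 2 (k * 2)) 2k+2≤d) ⟩
    sign (H (d ∸ k * 2) (t + k * 2 ∸ k * 2) 2)
      ≡⟨ cong (λ m → sign (H (d ∸ k * 2) m 2)) (ℕ.m+n∸n≡m t (k * 2)) ⟩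
    sign (H (d ∸ k * 2) t 2) ∎

  sign-even-1 : ∀ k {d} → suc k * 2 ≤ d → sign (H d (suc (k * 2)) (suc k * 2)) ≡ Sign.+
  sign-even-1 k 2k+2≤d = trans (sign-even-reduce k 1 2k+2≤d (s≤s z≤n)) (sign-second₁ (ℕ.m+n≤o⇒m≤o∸n 2 2k+2≤d))

  sign-even-2 : ∀ k {d} → suc k * 2 ≤ d → sign (H d (k * 2) (suc k * 2)) ≡ Sign.-
  sign-even-2 k 2k+2≤d = trans (sign-even-reduce k 0 2k+2≤d z≤n) (sign-second₀ (ℕ.m+n≤o⇒m≤o∸n 2 2k+2≤d))

-- The smallest eigenvalue for odd and for even `j`.

odd⇒≡k*2+1 : ∀ j → 2 ∤ j → ∃ λ k → j ≡ k * 2 + 1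
odd⇒≡k*2+1 0             2∤j = contradiction (divides 0 refl) 2∤j
odd⇒≡k*2+1 1             _   = 0 , refl
odd⇒≡k*2+1 (suc (suc j)) 2∤j
  with k , refl ← odd⇒≡k*2+1 j (λ { (divides k refl) → 2∤j (divides (suc k) refl) })
  = suc k , refl

module Minima (q : ℕ) (4≤q : 4 ≤ q) where
  open Signs
  open Estimates q 4≤q
  open EigenvalueSigns q 4≤q
  open Recurrences.Eigenvalues b

  ∣H∣-mono-≤ : ∀ {d j m n} → 1 ≤ j → j ≤ d → m ≤ n → n ≤ d → ℤ.∣ H d m j ∣ ≤ ℤ.∣ H d n j ∣
  ∣H∣-mono-≤ {n = n} 1≤j j≤d m≤n n≤d with ℕ.m≤n⇒m<n∨m≡n m≤n
  ... | inj₂ refl = ℕ.≤-refl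
  ∣H∣-mono-≤ {n = suc n} 1≤j j≤d m≤n n<d | inj₁ (s≤s m≤n-1) = ℕ.≤-trans
    (∣H∣-mono-≤ 1≤j j≤d m≤n-1 (ℕ.<⇒≤ n<d))
    (ℕ.<⇒≤ (∣H∣-increasing n<d _ 1≤j j≤d))

  -- The value at `m = d ∸ 1`, i.e. `i = 1`, is negative and the largest in absolute value among all
  -- `m < d`; the one at `m = d` is positive.
  odd-minimum : ∀ k {d} m → k * 2 + 1 ≤ d → m ≤ d → H d (d ∸ 1) (k * 2 + 1) ℤ.≤ H d m (k * 2 + 1)
  odd-minimum k {zero}  m j≤d m≤d = contradiction (ℕ.≤-trans (ℕ.m≤n+m 1 (k * 2)) j≤d) λ ()
  odd-minimum k {suc d} m j≤d m≤d = by-cases (ℕ.m≤n⇒m<n∨m≡n m≤d)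
    where
    2k≤d : k * 2 ≤ d
    2k≤d = ℕ.≤-pred (subst (_≤ suc d) (ℕ.+-comm (k * 2) 1) j≤d)
    by-cases : m < suc d ⊎ m ≡ suc d → H (suc d) d (k * 2 + 1) ℤ.≤ H (suc d) m (k * 2 + 1)
    by-cases (inj₁ (s≤s m≤d-1)) = negative⇒≤ (sign-odd-1 k 2k≤d)
      (∣H∣-mono-≤ (ℕ.m≤n+m 1 (k * 2)) j≤d m≤d-1 (ℕ.n≤1+n d))
    by-cases (inj₂ refl) = opposite-signs⇒≤ (sign-odd-1 k 2k≤d) (sign-odd-0 k j≤d)

  -- The value at `m = j - 2` is negative and dominates those at smaller `m` in absolute value; from
  -- `m = j - 1` on all values are positive.
  even-minimum : ∀ k {d} m → suc k * 2 ≤ d → m ≤ d → H d (k * 2) (suc k * 2) ℤ.≤ H d m (suc k * 2)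
  even-minimum k m j≤d m≤d with m ℕ.≤? k * 2
  ... | yes m≤2k = negative⇒≤ (sign-even-2 k j≤d)
    (∣H∣-mono-≤ (s≤s z≤n) j≤d m≤2k (ℕ.≤-trans (ℕ.m≤n+m (k * 2) 2) j≤d))
  ... | no m≰2k = opposite-signs⇒≤ (sign-even-2 k j≤d) (nonnegative (ℕ.m≤n⇒m<n∨m≡n (ℕ.≰⇒> m≰2k)))
    where
    nonnegative : suc (k * 2) < m ⊎ suc (k * 2) ≡ m → ℤ.sign (H _ m (suc k * 2)) ≡ Sign.+
    nonnegative (inj₁ j≤m) = sign-even-large (suc k) j≤m m≤d
    nonnegative (inj₂ refl) = sign-even-1 k j≤d

-- Transfer of the results on `H` to `Q`.

theorem9p5 : (q : ℕ) .{{_ : NonTrivial q}} → IsPrimePower q → 4 ≤ q →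
    (d : ℕ) → 1 ≤ d → (j : ℕ) → 1 ≤ j → j ≤ d →
    (3 ≤ d → ∀ i → i < d → ℚ.∣ Q q d j (suc i) ∣ ℚ.< ℚ.∣ Q q d j i ∣)
    × (2 ∤ j → ∀ i → i ≤ d → Q q d j 1 ℚ.≤ Q q d j i)
    × (2 ∣ j → ∀ i → i ≤ d → Q q d j (d ∸ j + 2) ℚ.≤ Q q d j i)
theorem9p5 q@(suc (suc _)) _ 4≤q d _ j 1≤j j≤d = monotone , odd , even
  where
  open Integrality using (Q≡H; fromℤ-mono-≤; fromℤ-abs-mono-<)
  open Estimates q 4≤q
  open Minima q 4≤q
  open Recurrences.Eigenvalues b

  transfer : ∀ i i′ → H d (d ∸ i) j ℤ.≤ H d (d ∸ i′) j → Q q d j i ℚ.≤ Q q d j i′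
  transfer i i′ H≤H = subst₂ ℚ._≤_ (sym (Q≡H q i j≤d)) (sym (Q≡H q i′ j≤d)) (fromℤ-mono-≤ H≤H)

  monotone : 3 ≤ d → ∀ i → i < d → ℚ.∣ Q q d j (suc i) ∣ ℚ.< ℚ.∣ Q q d j i ∣
  monotone _ i i<d = subst₂ (λ x y → ℚ.∣ x ∣ ℚ.< ℚ.∣ y ∣)
    (sym (Q≡H q (suc i) j≤d)) (sym (Q≡H q i j≤d))
    (fromℤ-abs-mono-< {H d (d ∸ suc i) j} {H d (d ∸ i) j} (subst (λ m → ℤ.∣ H d (d ∸ suc i) j ∣ < ℤ.∣ H d m j ∣) (sym d∸i≡1+m)
      (∣H∣-increasing (subst (_≤ d) d∸i≡1+m (ℕ.m∸n≤m d i)) j 1≤j j≤d)))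
    where
    d∸i≡1+m : d ∸ i ≡ suc (d ∸ suc i)
    d∸i≡1+m = ℕ.+-∸-assoc 1 i<d

  odd : 2 ∤ j → ∀ i → i ≤ d → Q q d j 1 ℚ.≤ Q q d j i
  odd 2∤j i _ with k , refl ← odd⇒≡k*2+1 j 2∤j =
    transfer 1 i (odd-minimum k (d ∸ i) j≤d (ℕ.m∸n≤m d i))

  even : 2 ∣ j → ∀ i → i ≤ d → Q q d j (d ∸ j + 2) ℚ.≤ Q q d j i
  even (divides zero refl)    = contradiction 1≤j λ ()
  even (divides (suc k) refl) i _ = transfer (d ∸ j + 2) i
    (subst (λ m → H d m j ℤ.≤ H d (d ∸ i) j) (sym index)
      (even-minimum k (d ∸ i) j≤d (ℕ.m∸n≤m d i)))
    where
    -- The index `i = d - j + 2` corresponds to `m = j - 2`, which is `k * 2`.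
    index : d ∸ (d ∸ j + 2) ≡ k * 2
    index = trans (sym (ℕ.∸-+-assoc d (d ∸ j) 2)) (cong (_∸ 2) (ℕ.m∸[m∸n]≡n j≤d))
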